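{- There exists a universal constant $K>0$ such that the following holds. Let $G=(V,E,w)$ be a weighted graph that admits a $(\beta,s,\Delta)$-sparse cover, where $\beta>0$, $\Delta>0$ and $s\ge 1$ is an integer. Then $G$ admits a $\left(K\beta\log s,\ \frac{1}{4\beta},\ \Delta\right)$-padded decomposition.
   Context: Graphs $G=(V,E,w)$ are finite, connected and undirected, with edge weights $w:E\to\mathbb{R}_{\ge 0}$; $d_G$ is the shortest path (pseudo)metric, and $B_G(z,r)=\{u\in V: d_G(z,u)\le r\}$ is the closed ball. Logarithms are base $2$. The (weak) diameter of a cluster $C\subseteq V$ is $\max_{u,v\in C}d_G(u,v)$ (distances measured in the whole graph $G$). A collection $\mathcal C=\{C_1,\dots,C_t\}$ of subsets of $V$ (clusters) is a $(\beta,s,\Delta)$-sparse cover of $G$ if: (1) every $C_i$ has diameter at most $\Delta$; (2) for each $v\in V$ there is $C_i\in\mathcal C$ with $B_G(v,\Delta/\beta)\subseteq C_i$; (3) each $v\in V$ belongs to at most $s$ clusters of $\mathcal C$. A partition $\mathcal P$ of $V$ is $\Delta$-bounded if every cluster of $\mathcal P$ has weak diameter at most $\Delta$; $P(z)$ denotes the cluster of $\mathcal P$ containing $z$. A distribution $\mathcal D$ over partitions of $V$ is a $(\beta',\delta,\Delta)$-padded decomposition of $G$ if every $\mathcal P\in\mathrm{supp}(\mathcal D)$ is $\Delta$-bounded and for every $0\le\gamma\le\delta$ and $z\in V$, $\Pr_{\mathcal P\sim\mathcal D}[B_G(z,\gamma\Delta)\subseteq P(z)]\ge e^{ -\beta'\gamma}$.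 -}

module Defs where

open import Algebra.Bundles using (CommutativeRing; Semiring)
open import Algebra.Structures using (IsCommutativeRing)
import Algebra.Definitions.RawSemiring as RawSemiringOps
open import Axiom.ExcludedMiddle using (ExcludedMiddle)
open import Data.Bool.Base using (if_then_else_)
open import Data.Fin.Base using (Fin; toℕ)
open import Data.Fin.Subset using (Subset; _∈_; _⊆_; _∩_; Nonempty; Empty)
open import Data.Fin.Subset.Properties using (_∈?_; _⊆?_)
open import Data.List.Base using (List; length; filter)
open import Data.List.Relation.Unary.All using (All)
open import Data.List.Relation.Unary.AllPairs using (AllPairs)
open import Data.List.Relation.Unary.Any as Any using (Any)
open import Data.Nat.Base as ℕ using (ℕ; _!)
open import Data.Product.Base using (_×_; Σ; ∃)
open import Data.Vec.Base using (tabulate)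
open import Level using (0ℓ)
open import Relation.Binary.Construct.Closure.ReflexiveTransitive
  using (Star; ε; _◅_)
import Relation.Binary.Construct.NonStrictToStrict as NonStrictToStrict
open import Relation.Binary.Core using (Rel)
open import Relation.Binary.Definitions using (Irreflexive; Symmetric)
open import Relation.Binary.PropositionalEquality.Core using (_≡_; _≢_)
open import Relation.Binary.Structures using (IsTotalOrder)
open import Relation.Nullary.Decidable.Core using (Dec; does)
open import Relation.Unary using (Pred; Decidable)

-- The real numbers, axiomatised as a Dedekind-complete totally ordered field;
-- classically these axioms determine ℝ up to unique isomorphism.
record CompleteOrderedField : Set₁ where
  infix  9 _⁻¹
  infix  8 -_
  infixl 7 _*_ _÷_
  infixl 6 _+_
  infix  4 _≤_
  field
    ℝ       : Set
    _+_ _*_ : ℝ → ℝ → ℝ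
    -_      : ℝ → ℝ
    0# 1#   : ℝ
    -- Total; 0# ⁻¹ is unspecified.
    _⁻¹     : ℝ → ℝ
    _≤_     : Rel ℝ 0ℓ
    isCommutativeRing : IsCommutativeRing _≡_ _+_ _*_ -_ 0# 1#
    0≢1               : 0# ≢ 1#
    *-inverseʳ        : ∀ {x} → x ≢ 0# → x * x ⁻¹ ≡ 1#
    isTotalOrder      : IsTotalOrder _≡_ _≤_
    +-monoˡ-≤         : ∀ z {x y} → x ≤ y → x + z ≤ y + z
    *-nonNeg          : ∀ {x y} → 0# ≤ x → 0# ≤ y → 0# ≤ x * y

  UpperBound : Pred ℝ 0ℓ → Pred ℝ 0ℓ
  UpperBound P b = ∀ {x} → P x → x ≤ b

  field
    -- ⨆ P is unspecified unless P is inhabited and bounded above.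
    ⨆       : Pred ℝ 0ℓ → ℝ
    ⨆-upper : ∀ P → ∃ P → ∃ (UpperBound P) → UpperBound P (⨆ P)
    ⨆-least : ∀ P → ∃ P → ∃ (UpperBound P) →
              ∀ {b} → UpperBound P b → ⨆ P ≤ b

  commutativeRing : CommutativeRing 0ℓ 0ℓ
  commutativeRing = record { isCommutativeRing = isCommutativeRing }

  open RawSemiringOps
    (Semiring.rawSemiring (CommutativeRing.semiring commutativeRing)) public
    using (_^_; sum) renaming (_×_ to _·_)

  open NonStrictToStrict _≡_ _≤_ public using (_<_)

  _÷_ : ℝ → ℝ → ℝ
  x ÷ y = x * y ⁻¹

  ⨅ : Pred ℝ 0ℓ → ℝ
  ⨅ P = - ⨆ (λ x → P (- x))

  fromℕ : ℕ → ℝ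
  fromℕ n = n · 1#

module Theory (lem : ExcludedMiddle 0ℓ) (R : CompleteOrderedField) where

  open CompleteOrderedField R public

  _≤?_ : (x y : ℝ) → Dec (x ≤ y)
  x ≤? y = lem

  expPartialSum : ℝ → ℕ → ℝ
  expPartialSum x m = sum {m} λ k → x ^ toℕ k ÷ fromℕ (toℕ k !)

  -- For x ≥ 0 the partial sums are nondecreasing and bounded, so their
  -- supremum is the sum of the exponential series.
  expSeries : ℝ → ℝ
  expSeries x = ⨆ λ y → ∃ λ m → y ≡ expPartialSum x m

  exp : ℝ → ℝ
  exp x = if does (0# ≤? x) then expSeries x else expSeries (- x) ⁻¹

  -- Meaningful for x > 0 only, as is log₂.
  ln : ℝ → ℝ
  ln x = ⨆ λ y → exp y ≤ x

  log₂ : ℝ → ℝ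
  log₂ x = ln x ÷ ln (fromℕ 2)

  record WeightedGraph (n : ℕ) : Set₁ where
    field
      Adj        : Rel (Fin n) 0ℓ
      adj-sym    : Symmetric Adj
      adj-irrefl : Irreflexive _≡_ Adj
      connected  : ∀ u v → Star Adj u v
      -- Only the values at adjacent pairs matter.
      weight        : Fin n → Fin n → ℝ
      weight-sym    : ∀ {u v} → Adj u v → weight u v ≡ weight v u
      weight-nonNeg : ∀ {u v} → Adj u v → 0# ≤ weight u v

    walkLength : ∀ {u v} → Star Adj u v → ℝ
    walkLength ε                     = 0#
    walkLength (_◅_ {u} {v} _ walk) = weight u v + walkLength walk

    dist : Fin n → Fin n → ℝ
    dist u v = ⨅ λ x → Σ (Star Adj u v) λ walk → x ≡ walkLength walk

    ball : Fin n → ℝ → Subset n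
    ball z r = tabulate λ u → does (dist z u ≤? r)

    -- Weak diameter at most Δ: distances are measured in the whole graph.
    DiameterAtMost : ℝ → Subset n → Set
    DiameterAtMost Δ C = ∀ {u v} → u ∈ C → v ∈ C → dist u v ≤ Δ

  open WeightedGraph public

  record IsSparseCover {n} (G : WeightedGraph n) (β : ℝ) (s : ℕ) (Δ : ℝ)
                       (𝒞 : List (Subset n)) : Set where
    field
      bounded : All (DiameterAtMost G Δ) 𝒞
      padded  : ∀ v → Any (ball G v (Δ ÷ β) ⊆_) 𝒞
      sparse  : ∀ v → length (filter (v ∈?_) 𝒞) ℕ.≤ s

  HasSparseCover : ∀ {n} → WeightedGraph n → ℝ → ℕ → ℝ → Set
  HasSparseCover G β s Δ = ∃ (IsSparseCover G β s Δ)

  record Partition (n : ℕ) : Set where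
    field
      clusters : List (Subset n)
      nonempty : All Nonempty clusters
      disjoint : AllPairs (λ C D → Empty (C ∩ D)) clusters
      covers   : ∀ v → Any (v ∈_) clusters

    clusterOf : Fin n → Subset n
    clusterOf z = Any.lookup (covers z)

  open Partition public

  -- A finite set has finitely many partitions, so finitely supported
  -- distributions are the general case.  Outcomes may repeat or have mass 0.
  record Distribution (A : Set) : Set where
    field
      size        : ℕ
      outcome     : Fin size → A
      mass        : Fin size → ℝ
      mass-nonNeg : ∀ i → 0# ≤ mass i
      mass-total  : sum mass ≡ 1#

    _∈supp : A → Set
    x ∈supp = ∃ λ i → outcome i ≡ x × 0# < mass i

    Pr : {E : Pred A 0ℓ} → Decidable E → ℝ
    Pr E? = sum λ i → if does (E? (outcome i)) then mass i else 0#

  open Distribution public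

  record IsPaddedDecomposition {n} (G : WeightedGraph n) (β′ δ Δ : ℝ)
                               (𝒟 : Distribution (Partition n)) : Set where
    field
      bounded : ∀ P → _∈supp 𝒟 P → All (DiameterAtMost G Δ) (clusters P)
      padded  : ∀ γ z → 0# ≤ γ → γ ≤ δ →
                exp (- (β′ * γ))
                  ≤ Pr 𝒟 (λ P → ball G z (γ * Δ) ⊆? clusterOf P z)

  HasPaddedDecomposition : ∀ {n} → WeightedGraph n → ℝ → ℝ → ℝ → Set
  HasPaddedDecomposition G β′ δ Δ = ∃ (IsPaddedDecomposition G β′ δ Δ)

{-# OPTIONS --safe #-}
-- Idea.  Let q = 1 / (4 β) and let N h = q Δ, with N so large that every
-- nonzero distance is at least h.  Draw a uniformly random order of the clusters
-- of the cover and a radius r = (N + k) h with k < 2 N uniform, and put each vertex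
-- v into the first cluster containing its r-ball (Calinescu–Karloff–Rabani).
-- Let ℓ h ≤ 2 γ Δ bound a ball around z.  It is not cut if, among the clusters
-- containing the ball of radius r − ℓ h around z, the first one even contains the
-- ball of radius r + ℓ h.  With f j the number of clusters containing the
-- ball of radius j h around z, this has probability f (N + k + ℓ) / f (N + k − ℓ)
-- over the orders.  By the AM-GM inequality the average over k is at least the
-- geometric mean, which telescopes (Mendel–Naor), and 1 ≤ f ≤ s bounds it
-- below by s ^ (− 2 ℓ / (2 N)), where ℓ / N ≤ 8 β γ.
module Submission where

open import Defs
open import Algebra.Bundles using (CommutativeRing)
import Algebra.Properties.CommutativeSemiring.Binomial as BinomialTheorem
import Algebra.Properties.Ring as RingProperties
import Algebra.Properties.Semiring.Exp as SemiringExp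
import Algebra.Properties.Semiring.Mult as SemiringMult
import Algebra.Properties.Semiring.Sum as SemiringSum
import Algebra.Solver.Ring.NaturalCoefficients.Default as SemiringSolver
open import Axiom.ExcludedMiddle using (ExcludedMiddle)
open import Data.Bool.Base using (if_then_else_)
open import Data.Fin.Base using (Fin; zero; suc; toℕ)
import Data.Fin.Properties as Fin
open import Data.Fin.Subset using (Subset; _∈_; _⊆_)
open import Data.Fin.Subset.Properties using (_∈?_; _⊆?_; nonempty?; x∈p∩q⁻)
open import Data.List.Base as List
  using (List; []; _∷_; length; applyUpTo; filter; map; concatMap; upTo; lookup)
open import Data.List.Membership.Propositional using () renaming (_∈_ to _∈ˡ_)
open import Data.List.Membership.Propositional.Properties using (∈-filter⁺; ∈-tabulate⁺; ∈-lookup; ∈-upTo⁻)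
open import Data.List.Properties
  using (length-applyUpTo; length-++; length-map; length-upTo; map-upTo; filter-++; filter-all; filter-none; filter-some)
open import Data.List.Relation.Binary.Permutation.Propositional using (_↭_; ↭-refl; ↭-sym; ↭-trans; prep; swap)
open import Data.List.Relation.Binary.Permutation.Propositional.Properties
  using (↭-length; filter-↭; All-resp-↭; Any-resp-↭)
open import Data.List.Relation.Unary.All as All using (All; []; _∷_)
import Data.List.Relation.Unary.All.Properties as All
import Data.List.Relation.Unary.AllPairs.Properties as AllPairs
open import Data.List.Relation.Unary.Any as Any using (Any; here; there)
open import Data.Nat.Base as ℕ using (ℕ; zero; suc; z≤n; s≤s; _!)
open import Data.Nat.Combinatorics using (_C_; nCk≡n!/k![n-k]!; k![n∸k]!∣n!)
open import Data.Nat.DivMod using (m/n*n≡m; m≡m%n+[m/n]*n; m%n<n; m/n*n≤m; m≥n⇒m/n>0)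
import Data.Nat.ListAction as ListAction
import Data.Nat.Properties as ℕ
open import Data.Nat.Tactic.RingSolver using (solve-∀)
open import Data.Product.Base using (_×_; _,_; ∃; Σ; proj₁; proj₂; map₂)
open import Data.Sum.Base using (_⊎_; inj₁; inj₂)
open import Data.Vec.Base using (tabulate)
open import Data.Vec.Properties using (lookup⇒[]=; []=⇒lookup; lookup∘tabulate)
open import Function.Base using (_∘_; id)
open import Level using (0ℓ)
open import Relation.Binary.Bundles using (TotalOrder)
open import Relation.Binary.Construct.Closure.ReflexiveTransitive using (Star; ε; _◅_; _◅◅_)
open import Relation.Binary.PropositionalEquality using (_≡_; _≢_; refl; sym; trans; cong; cong₂; subst; subst₂)
import Relation.Binary.Reasoning.PartialOrder as PartialOrderReasoning
open import Relation.Nullary using (¬_; yes; no; does; contradiction)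
open import Relation.Nullary.Decidable using (dec-true)
open import Relation.Unary using (Pred; Decidable)

-- AM-GM and telescoping products

-- The radius runs over a finite grid because a `Distribution` is finitely supported. All outcomes
-- then have the same mass, every probability is a ratio of counts, and the random argument becomes
-- one inequality between natural numbers. Real numbers return only to compare s ^ (2 ℓ) with a 2
-- N-th power of the exponential, and roots are taken by cancelling equal exponents. The 4 in q
-- leaves room on both sides of the radius: γ ≤ q gives ℓ ≤ N, hence r - ℓ h ≥ 0 and r + ℓ h ≤ 4 N h
-- = Δ / β. So every ball that is counted lies in some cluster of the cover, and every vertex is
-- assigned to a cluster. The constant is 32 ln 2 with 32 = 8 · 2 · 2. The 8 comes from ℓ ≤ 8 β γ N
-- (the 4 in q and the rounding of γ Δ to a multiple of h), one 2 from replacing N / ℓ by its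
-- integer part, one 2 from using s ≤ exp (2 ln s). The factor ln 2 converts the binary logarithm.

module _ where
  open import Data.Nat.Base using (_+_; _*_; _^_; _≤_)
  open ListAction using (sum; product)
  open ℕ.≤-Reasoning

  ^-distribʳ-* : ∀ n a b → (a * b) ^ n ≡ a ^ n * b ^ n
  ^-distribʳ-* zero    a b = refl
  ^-distribʳ-* (suc n) a b = trans (cong (a * b *_) (^-distribʳ-* n a b)) (identity a b (a ^ n) (b ^ n))
    where
    identity : ∀ a b p q → a * b * (p * q) ≡ a * p * (b * q)
    identity = solve-∀

  -- This is (u - v)² ≥ 0 without subtraction: lowering both variables by one lowers both sides by
  -- the same amount.
  2uv≤u²+v² : ∀ u v → 2 * (u * v) ≤ u * u + v * v
  2uv≤u²+v² zero    v       = z≤n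
  2uv≤u²+v² (suc u) zero    = ℕ.≤-trans (ℕ.≤-reflexive (cong (2 *_) (ℕ.*-zeroʳ u))) z≤n
  2uv≤u²+v² (suc u) (suc v) = subst₂ _≤_ (identity u v) (identity′ u v)
    (ℕ.+-monoˡ-≤ (2 * u + 2 * v + 2) (2uv≤u²+v² u v))
    where
    identity : ∀ u v → 2 * (u * v) + (2 * u + 2 * v + 2) ≡ 2 * (suc u * suc v)
    identity = solve-∀
    identity′ : ∀ u v → u * u + v * v + (2 * u + 2 * v + 2) ≡ suc u * suc u + suc v * suc v
    identity′ = solve-∀

  -- AM-GM for one copy of v ^ (n + 1) and n copies of u ^ (n + 1). In the induction, adding
  -- `n * (u ^ suc n * v)` to both sides makes the coefficient 2 (n + 1), so that a factor 2 u v can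
  -- be split off and replaced by u² + v².
  weighted-am-gm : ∀ n u v → suc n * (u ^ n * v) ≤ v ^ suc n + n * u ^ suc n
  weighted-am-gm zero    u v = ℕ.≤-reflexive (identity v)
    where
    identity : ∀ v → 1 * (1 * v) ≡ v * 1 + 0
    identity = solve-∀
  weighted-am-gm (suc n) u v = ℕ.+-cancelʳ-≤ (n * (u ^ suc n * v)) _ _ (begin
    suc (suc n) * (u ^ suc n * v) + n * (u ^ suc n * v)
      ≡⟨ identity₁ n (u ^ n) u v ⟩
    suc n * (u ^ n * (2 * (u * v)))
      ≤⟨ ℕ.*-monoʳ-≤ (suc n) (ℕ.*-monoʳ-≤ (u ^ n) (2uv≤u²+v² u v)) ⟩
    suc n * (u ^ n * (u * u + v * v))
      ≡⟨ identity₂ n (u ^ n) u v ⟩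
    suc n * (u ^ n * v) * v + suc n * u ^ suc (suc n)
      ≤⟨ ℕ.+-monoˡ-≤ _ (ℕ.*-monoˡ-≤ v (weighted-am-gm n u v)) ⟩
    (v ^ suc n + n * u ^ suc n) * v + suc n * u ^ suc (suc n)
      ≡⟨ identity₃ n (v ^ n) (u ^ n) u v ⟩
    v ^ suc (suc n) + suc n * u ^ suc (suc n) + n * (u ^ suc n * v) ∎)
    where
    identity₁ : ∀ n p u v → suc (suc n) * (u * p * v) + n * (u * p * v) ≡ suc n * (p * (2 * (u * v)))
    identity₁ = solve-∀
    identity₂ : ∀ n p u v → suc n * (p * (u * u + v * v)) ≡ suc n * (p * v) * v + suc n * (u * (u * p))
    identity₂ = solve-∀
    identity₃ : ∀ n q p u v → (v * q + n * (u * p)) * v + suc n * (u * (u * p))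
                            ≡ v * (v * q) + suc n * (u * (u * p)) + n * (u * p * v)
    identity₃ = solve-∀

  -- weighted-am-gm at u = (n + 1) S and v = n (S + x)
  am-gm-step : ∀ n S x → suc n ^ suc n * (S ^ n * x) ≤ n ^ n * (x + S) ^ suc n
  am-gm-step zero      S x = subst₂ _≤_ (identity x) (identity′ x S) (ℕ.m≤m+n x S)
    where
    identity : ∀ x → x ≡ 1 * (1 * x)
    identity = solve-∀
    identity′ : ∀ x S → x + S ≡ 1 * ((x + S) * 1)
    identity′ = solve-∀
  -- The summand S in v reproduces `n * u ^ suc n` on the left, which cancels against the right
  -- side. A common factor n remains to be cancelled, hence the separate case n = 0.
  am-gm-step n@(suc _) S x = ℕ.*-cancelˡ-≤ n (ℕ.+-cancelʳ-≤ (n * (u * (suc n ^ n * S ^ n))) _ _ (begin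
    n * (suc n ^ suc n * (S ^ n * x)) + n * (u * (suc n ^ n * S ^ n))
      ≡⟨ identity₁ n (suc n ^ n) (S ^ n) S x ⟩
    suc n * ((suc n ^ n * S ^ n) * v)
      ≡⟨ cong (λ p → suc n * (p * v)) (sym (^-distribʳ-* n (suc n) S)) ⟩
    suc n * (u ^ n * v)
      ≤⟨ weighted-am-gm n u v ⟩
    v ^ suc n + n * u ^ suc n
      ≡⟨ cong₂ (λ p q → v * p + n * (u * q)) (^-distribʳ-* n n (x + S)) (^-distribʳ-* n (suc n) S) ⟩
    v * (n ^ n * (x + S) ^ n) + n * (u * (suc n ^ n * S ^ n))
      ≡⟨ cong (_+ n * (u * (suc n ^ n * S ^ n))) (identity₂ n (x + S) (n ^ n) ((x + S) ^ n)) ⟩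
    n * (n ^ n * (x + S) ^ suc n) + n * (u * (suc n ^ n * S ^ n)) ∎))
    where
    u = suc n * S
    v = n * (x + S)
    identity₁ : ∀ n p q S x → n * (suc n * p * (q * x)) + n * (suc n * S * (p * q)) ≡ suc n * ((p * q) * (n * (x + S)))
    identity₁ = solve-∀
    identity₂ : ∀ n y p q → n * y * (p * q) ≡ n * (p * (y * q))
    identity₂ = solve-∀

  -- The convention 0 ^ 0 = 1 lets the induction of `am-gm` pass from the empty list to a single
  -- entry.
  n^n≢0 : ∀ n → ℕ.NonZero (n ^ n)
  n^n≢0 zero    = _
  n^n≢0 (suc n) = ℕ.m^n≢0 (suc n) (suc n)

  am-gm : ∀ xs → length xs ^ length xs * product xs ≤ sum xs ^ length xs
  am-gm []       = ℕ.≤-refl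
  am-gm (x ∷ xs) = ℕ.*-cancelˡ-≤ (n ^ n) {{n^n≢0 n}} (begin
    n ^ n * (suc n ^ suc n * (x * product xs))   ≡⟨ identity₁ (n ^ n) (suc n ^ suc n) x (product xs) ⟩
    suc n ^ suc n * (n ^ n * product xs * x)     ≤⟨ ℕ.*-monoʳ-≤ (suc n ^ suc n) (ℕ.*-monoˡ-≤ x (am-gm xs)) ⟩
    suc n ^ suc n * (sum xs ^ n * x)             ≤⟨ am-gm-step n (sum xs) x ⟩
    n ^ n * (x + sum xs) ^ suc n                 ∎)
    where
    n = length xs
    identity₁ : ∀ a b x p → a * (b * (x * p)) ≡ b * (a * p * x)
    identity₁ = solve-∀

  ∏ ∑ : ℕ → (ℕ → ℕ) → ℕ
  ∏ n f = product (applyUpTo f n)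
  ∑ n f = sum (applyUpTo f n)

  ∏-cong : ∀ n {f g : ℕ → ℕ} → (∀ i → i ℕ.< n → f i ≡ g i) → ∏ n f ≡ ∏ n g
  ∏-cong zero    f≡g = refl
  ∏-cong (suc n) f≡g = cong₂ _*_ (f≡g 0 (s≤s z≤n)) (∏-cong n λ i i<n → f≡g (suc i) (s≤s i<n))

  ∏-* : ∀ n (f g : ℕ → ℕ) → ∏ n (λ i → f i * g i) ≡ ∏ n f * ∏ n g
  ∏-* zero    f g = refl
  ∏-* (suc n) f g = trans (cong (f 0 * g 0 *_) (∏-* n (f ∘ suc) (g ∘ suc)))
                          (identity (f 0) (g 0) (∏ n (f ∘ suc)) (∏ n (g ∘ suc)))
    where
    identity : ∀ a b p q → a * b * (p * q) ≡ a * p * (b * q)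
    identity = solve-∀

  ∏-const : ∀ n a → ∏ n (λ _ → a) ≡ a ^ n
  ∏-const zero    a = refl
  ∏-const (suc n) a = cong (a *_) (∏-const n a)

  ∏-+ : ∀ m n f → ∏ (m + n) f ≡ ∏ m f * ∏ n (λ i → f (m + i))
  ∏-+ zero    n f = sym (ℕ.*-identityˡ _)
  ∏-+ (suc m) n f = trans (cong (f 0 *_) (∏-+ m n (f ∘ suc))) (sym (ℕ.*-assoc (f 0) _ _))

  ∏-≤-^ : ∀ n f a → (∀ i → i ℕ.< n → f i ≤ a) → ∏ n f ≤ a ^ n
  ∏-≤-^ zero    f a f≤a = ℕ.≤-refl
  ∏-≤-^ (suc n) f a f≤a = ℕ.*-mono-≤ (f≤a 0 (s≤s z≤n)) (∏-≤-^ n (f ∘ suc) a λ i i<n → f≤a (suc i) (s≤s i<n))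

  1≤∏ : ∀ n f → (∀ i → i ℕ.< n → 1 ≤ f i) → 1 ≤ ∏ n f
  1≤∏ zero    f 1≤f = ℕ.≤-refl
  1≤∏ (suc n) f 1≤f = ℕ.*-mono-≤ (1≤f 0 (s≤s z≤n)) (1≤∏ n (f ∘ suc) λ i i<n → 1≤f (suc i) (s≤s i<n))

  -- Both sides multiply `f` over all indices below d + L, cut once at d and once at L. This is the
  -- telescoping, free of division.
  ∏-shift : ∀ L d f → ∏ L (λ k → f (d + k)) * ∏ d f ≡ ∏ d (λ i → f (L + i)) * ∏ L f
  ∏-shift L d f = begin-equality
    ∏ L (λ k → f (d + k)) * ∏ d f   ≡⟨ ℕ.*-comm (∏ L (λ k → f (d + k))) (∏ d f) ⟩
    ∏ d f * ∏ L (λ k → f (d + k))   ≡⟨ sym (∏-+ d L f) ⟩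
    ∏ (d + L) f                     ≡⟨ cong (λ n → ∏ n f) (ℕ.+-comm d L) ⟩
    ∏ (L + d) f                     ≡⟨ ∏-+ L d f ⟩
    ∏ L f * ∏ d (λ i → f (L + i))   ≡⟨ ℕ.*-comm (∏ L f) (∏ d (λ i → f (L + i))) ⟩
    ∏ d (λ i → f (L + i)) * ∏ L f   ∎

  -- The quotients f (k + d) / f k telescope, so their geometric mean over
  -- k < L is at least s^(-d/L); F k / a is such a quotient.
  telescoping-am-gm : ∀ L d s a (f F : ℕ → ℕ) →
    (∀ j → j ℕ.< L + d → 1 ≤ f j) → (∀ j → j ℕ.< L + d → f j ≤ s) →
    (∀ k → k ℕ.< L → F k * f k ≡ f (d + k) * a) →
    (L * a) ^ L ≤ ∑ L F ^ L * s ^ d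
  telescoping-am-gm L d s a f F 1≤f f≤s ratio = begin
    (L * a) ^ L              ≡⟨ ^-distribʳ-* L L a ⟩
    L ^ L * a ^ L            ≤⟨ ℕ.*-monoʳ-≤ (L ^ L) a^L≤∏F*s^d ⟩
    L ^ L * (∏ L F * s ^ d)  ≡⟨ sym (ℕ.*-assoc (L ^ L) (∏ L F) (s ^ d)) ⟩
    L ^ L * ∏ L F * s ^ d    ≤⟨ ℕ.*-monoˡ-≤ (s ^ d) L^L∏≤ ⟩
    ∑ L F ^ L * s ^ d        ∎
    where
    L^L∏≤ : L ^ L * ∏ L F ≤ ∑ L F ^ L
    L^L∏≤ = subst (λ n → n ^ n * ∏ L F ≤ ∑ L F ^ n) (length-applyUpTo F L) (am-gm (applyUpTo F L))
    1≤∏f : 1 ≤ ∏ L f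
    1≤∏f = 1≤∏ L f λ i i<L → 1≤f i (ℕ.≤-trans i<L (ℕ.m≤m+n L d))
    product-ratio : ∏ L F * ∏ L f ≡ ∏ L (λ k → f (d + k)) * a ^ L
    product-ratio = begin-equality
      ∏ L F * ∏ L f                        ≡⟨ sym (∏-* L F f) ⟩
      ∏ L (λ k → F k * f k)                ≡⟨ ∏-cong L ratio ⟩
      ∏ L (λ k → f (d + k) * a)            ≡⟨ ∏-* L (λ k → f (d + k)) (λ _ → a) ⟩
      ∏ L (λ k → f (d + k)) * ∏ L (λ _ → a) ≡⟨ cong (∏ L (λ k → f (d + k)) *_) (∏-const L a) ⟩
      ∏ L (λ k → f (d + k)) * a ^ L        ∎
    -- After telescoping only the d topmost values of f, each at least 1, and the d lowest, each at
    -- most s, survive.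
    a^L≤∏F*s^d : a ^ L ≤ ∏ L F * s ^ d
    a^L≤∏F*s^d = ℕ.*-cancelʳ-≤ _ _ (∏ L f) {{ℕ.>-nonZero 1≤∏f}} (begin
      a ^ L * ∏ L f
        ≤⟨ ℕ.*-monoʳ-≤ (a ^ L) (ℕ.m≤n*m (∏ L f) (∏ d (λ i → f (L + i))) {{ℕ.>-nonZero
             (1≤∏ d (λ i → f (L + i)) λ i i<d → 1≤f (L + i) (ℕ.+-monoʳ-< L i<d))}}) ⟩
      a ^ L * (∏ d (λ i → f (L + i)) * ∏ L f)
        ≡⟨ cong (a ^ L *_) (sym (∏-shift L d f)) ⟩
      a ^ L * (∏ L (λ k → f (d + k)) * ∏ d f)
        ≡⟨ identity₂ (a ^ L) (∏ L (λ k → f (d + k))) (∏ d f) ⟩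
      ∏ L (λ k → f (d + k)) * a ^ L * ∏ d f
        ≡⟨ cong (_* ∏ d f) (sym product-ratio) ⟩
      ∏ L F * ∏ L f * ∏ d f
        ≤⟨ ℕ.*-monoʳ-≤ (∏ L F * ∏ L f) (∏-≤-^ d f s λ i i<d → f≤s i (ℕ.≤-trans i<d (ℕ.m≤n+m d L))) ⟩
      ∏ L F * ∏ L f * s ^ d
        ≡⟨ identity₃ (∏ L F) (∏ L f) (s ^ d) ⟩
      ∏ L F * s ^ d * ∏ L f ∎)
      where
      identity₂ : ∀ a b c → a * (b * c) ≡ b * a * c
      identity₂ = solve-∀
      identity₃ : ∀ a b c → a * b * c ≡ a * c * b
      identity₃ = solve-∀

-- Uniformly random orders

module _ where
  open import Data.Nat.Base using (_+_; _*_; _^_; _≤_)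
  open ListAction using (sum; product)
  open ℕ.≤-Reasoning

  count : {A : Set} {P : Pred A 0ℓ} → Decidable P → List A → ℕ
  count P? = length ∘ filter P?

  count-↭ : {A : Set} {P : Pred A 0ℓ} (P? : Decidable P) {xs ys : List A} →
            xs ↭ ys → count P? xs ≡ count P? ys
  count-↭ P? p = ↭-length (filter-↭ P? p)

  count-map : {A B : Set} {P : Pred B 0ℓ} {Q : Pred A 0ℓ} (P? : Decidable P) (Q? : Decidable Q) (f : A → B) →
              (∀ x → (P (f x) → Q x) × (Q x → P (f x))) → ∀ xs → count P? (map f xs) ≡ count Q? xs
  count-map P? Q? f P⇔Q []       = refl
  count-map P? Q? f P⇔Q (x ∷ xs) with P? (f x) | Q? x
  ... | yes _ | yes _ = cong suc (count-map P? Q? f P⇔Q xs)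
  ... | no  _ | no  _ = count-map P? Q? f P⇔Q xs
  ... | yes p | no ¬q = contradiction (proj₁ (P⇔Q x) p) ¬q
  ... | no ¬p | yes q = contradiction (proj₂ (P⇔Q x) q) ¬p

  count-mono : {A : Set} {P Q : Pred A 0ℓ} (P? : Decidable P) (Q? : Decidable Q) →
               ∀ {xs} → All (λ x → P x → Q x) xs → count P? xs ≤ count Q? xs
  count-mono P? Q? []                = z≤n
  count-mono P? Q? {x ∷ _} (P⊆Q ∷ ps) with P? x | Q? x
  ... | yes _ | yes _ = s≤s (count-mono P? Q? ps)
  ... | no  _ | no  _ = count-mono P? Q? ps
  ... | no  _ | yes _ = ℕ.m≤n⇒m≤1+n (count-mono P? Q? ps)
  ... | yes p | no ¬q = contradiction (P⊆Q p) ¬q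

  count-concatMap : {A B : Set} {P : Pred B 0ℓ} (P? : Decidable P) (f : A → List B) →
                    ∀ xs → count P? (concatMap f xs) ≡ sum (map (count P? ∘ f) xs)
  count-concatMap P? f []       = refl
  count-concatMap P? f (x ∷ xs) = trans (cong length (filter-++ P? (f x) (concatMap f xs)))
    (trans (length-++ (filter P? (f x))) (cong (count P? (f x) +_) (count-concatMap P? f xs)))

  length-concatMap : {A B : Set} (f : A → List B) {c : ℕ} →
                     ∀ {xs} → All (λ x → length (f x) ≡ c) xs → length (concatMap f xs) ≡ length xs * c
  length-concatMap f []                 = refl
  length-concatMap f {xs = x ∷ xs} (eq ∷ eqs) =
    trans (length-++ (f x)) (cong₂ _+_ eq (length-concatMap f eqs))

  -- Entries are picked by position, not by value, so repeated clusters give separate orders and the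
  -- number of orders is always a factorial.
  select : {A : Set} → List A → List (A × List A)
  select []       = []
  select (x ∷ xs) = (x , xs) ∷ map (map₂ (x ∷_)) (select xs)

  select-↭ : {A : Set} (xs : List A) → All (λ (x , rest) → x ∷ rest ↭ xs) (select xs)
  select-↭ []       = []
  select-↭ (x ∷ xs) = ↭-refl ∷ All.map⁺ (All.map (λ {(y , _)} p → ↭-trans (swap y x ↭-refl) (prep x p)) (select-↭ xs))

  length-select : {A : Set} (xs : List A) → length (select xs) ≡ length xs
  length-select []       = refl
  length-select (x ∷ xs) = cong suc (trans (length-map (map₂ (x ∷_)) (select xs)) (length-select xs))

  -- The first argument is the length of the list.
  permutations : {A : Set} → ℕ → List A → List (List A)
  permutations zero    xs = [] ∷ []
  permutations (suc m) xs = concatMap (λ (x , rest) → map (x ∷_) (permutations m rest)) (select xs)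

  tail-length : {A : Set} {m : ℕ} {x : A} {xs rest : List A} → length xs ≡ suc m → x ∷ rest ↭ xs → length rest ≡ m
  tail-length eq p = ℕ.suc-injective (trans (↭-length p) eq)

  permutations-↭ : {A : Set} → ∀ m (xs : List A) → length xs ≡ m → All (_↭ xs) (permutations m xs)
  permutations-↭ zero    []  eq = ↭-refl ∷ []
  permutations-↭ (suc m) xs  eq = All.concat⁺ (All.map⁺ (All.map
    (λ {(x , rest)} p → All.map⁺ (All.map (λ q → ↭-trans (prep x q) p) (permutations-↭ m rest (tail-length eq p))))
    (select-↭ xs)))

  length-permutations : {A : Set} → ∀ m (xs : List A) → length xs ≡ m → length (permutations m xs) ≡ m !
  length-permutations zero    xs eq = refl
  length-permutations (suc m) xs eq = trans
    (length-concatMap _ (All.map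
      (λ {(x , rest)} p → trans (length-map (x ∷_) (permutations m rest)) (length-permutations m rest (tail-length eq p)))
      (select-↭ xs)))
    (cong (_* m !) (trans (length-select xs) eq))

  *-sum-map : {A : Set} (w : A → ℕ) (g : A × List A → ℕ) (c : ℕ) {xss : List (A × List A)} →
               All (λ y → c * g y ≡ w (proj₁ y)) xss → c * sum (map g xss) ≡ sum (map w (map proj₁ xss))
  *-sum-map w g c []         = ℕ.*-zeroʳ c
  *-sum-map w g c {y ∷ xss} (eq ∷ eqs) =
    trans (ℕ.*-distribˡ-+ c (g y) (sum (map g xss))) (cong₂ _+_ eq (*-sum-map w g c eqs))

  proj₁-select : {A : Set} (xs : List A) → map proj₁ (select xs) ≡ xs
  proj₁-select []       = refl
  proj₁-select (x ∷ xs) = cong (x ∷_) (trans (go (select xs)) (proj₁-select xs))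
    where
    go : ∀ ys → map proj₁ (map (map₂ (x ∷_)) ys) ≡ map proj₁ ys
    go []       = refl
    go (y ∷ ys) = cong (proj₁ y ∷_) (go ys)

  module _ {A : Set} {S T : Pred A 0ℓ} (S? : Decidable S) (T? : Decidable T) (S⊆T : ∀ {x} → S x → T x) where

    -- The event that the list meets `T` and its first entry in `T` lies in `S`; since S ⊆ T, `hit`
    -- can stop without mentioning `T`.
    data FirstIn : List A → Set where
      hit  : ∀ {x xs} → S x → FirstIn (x ∷ xs)
      skip : ∀ {x xs} → ¬ T x → FirstIn xs → FirstIn (x ∷ xs)

    firstIn? : Decidable FirstIn
    firstIn? []       = no λ ()
    firstIn? (x ∷ xs) with S? x
    ... | yes s = yes (hit s)
    ... | no ¬s with T? x
    ...   | yes t = no λ { (hit s) → ¬s s ; (skip ¬t _) → ¬t t }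
    ...   | no ¬t with firstIn? xs
    ...     | yes f = yes (skip ¬t f)
    ...     | no ¬f = no λ { (hit s) → ¬s s ; (skip _ f) → ¬f f }

    -- With a = |T| m ! and b = |S| m !, this is |T| times the number of favourable orders that
    -- start with x: all of them, none, or those favourable for the remaining entries.
    branch : ℕ → ℕ → A → ℕ
    branch a b x = if does (S? x) then a else if does (T? x) then 0 else b

    -- The value b is taken at the `length xs` - |T| entries outside `T`; the term with |T| is moved
    -- to the left to avoid the subtraction.
    sum-branch : ∀ a b xs → sum (map (branch a b) xs) + count T? xs * b ≡ count S? xs * a + length xs * b
    sum-branch a b []       = refl
    sum-branch a b (x ∷ xs) with S? x | T? x
    ... | yes s | no ¬t = contradiction (S⊆T s) ¬t
    ... | yes _ | yes _ = trans (identity a b (sum (map (branch a b) xs)) (count T? xs))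
                            (trans (cong (a + b +_) (sum-branch a b xs)) (identity′ a b (count S? xs) (length xs)))
      where
      identity : ∀ a b p q → (a + p) + suc q * b ≡ a + b + (p + q * b)
      identity = solve-∀
      identity′ : ∀ a b p q → a + b + (p * a + q * b) ≡ suc p * a + suc q * b
      identity′ = solve-∀
    ... | no  _ | yes _ = trans (identity a b (sum (map (branch a b) xs)) (count T? xs))
                            (trans (cong (b +_) (sum-branch a b xs)) (identity′ a b (count S? xs) (length xs)))
      where
      identity : ∀ a b p q → p + suc q * b ≡ b + (p + q * b)
      identity = solve-∀
      identity′ : ∀ a b p q → b + (p * a + q * b) ≡ p * a + suc q * b
      identity′ = solve-∀
    ... | no  _ | no  _ = trans (identity a b (sum (map (branch a b) xs)) (count T? xs))
                            (trans (cong (b +_) (sum-branch a b xs)) (identity′ a b (count S? xs) (length xs)))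
      where
      identity : ∀ a b p q → (b + p) + q * b ≡ b + (p + q * b)
      identity = solve-∀
      identity′ : ∀ a b p q → b + (p * a + q * b) ≡ p * a + suc q * b
      identity′ = solve-∀

    -- In a uniformly random order, the first element of T lies in S with
    -- probability |S| / |T|.
    count-firstIn : ∀ m xs → length xs ≡ m →
      count firstIn? (permutations m xs) * count T? xs ≡ count S? xs * m !
    count-firstIn zero    [] eq = refl
    -- The orders are split by their first entry. An entry outside `T` leaves both counts unchanged
    -- in the rest, so induction applies to it. The added term matches the subtraction-free form of
    -- `sum-branch`.
    count-firstIn (suc m) xs eq = ℕ.+-cancelʳ-≡ (t * (f * m !)) _ _ (begin-equality
      count firstIn? (permutations (suc m) xs) * t + t * (f * m !)
        ≡⟨ cong (λ c → c * t + t * (f * m !)) (count-concatMap firstIn? _ (select xs)) ⟩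
      sum (map g (select xs)) * t + t * (f * m !)
        ≡⟨ cong (_+ t * (f * m !)) (trans (ℕ.*-comm _ t)
             (*-sum-map (branch (t * m !) (f * m !)) g t (All.map (λ {y} → cases {y}) (select-↭ xs)))) ⟩
      sum (map (branch (t * m !) (f * m !)) (map proj₁ (select xs))) + t * (f * m !)
        ≡⟨ cong (λ ys → sum (map (branch (t * m !) (f * m !)) ys) + t * (f * m !)) (proj₁-select xs) ⟩
      sum (map (branch (t * m !) (f * m !)) xs) + t * (f * m !)
        ≡⟨ sum-branch (t * m !) (f * m !) xs ⟩
      f * (t * m !) + length xs * (f * m !)
        ≡⟨ cong (λ l → f * (t * m !) + l * (f * m !)) eq ⟩
      f * (t * m !) + suc m * (f * m !)
        ≡⟨ identity f t m (m !) ⟩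
      f * (suc m) ! + t * (f * m !) ∎)
      where
      t = count T? xs
      f = count S? xs
      identity : ∀ f t m p → f * (t * p) + suc m * (f * p) ≡ f * (p + m * p) + t * (f * p)
      identity = solve-∀
      g : A × List A → ℕ
      g (x , rest) = count firstIn? (map (x ∷_) (permutations m rest))
      cases : ∀ {y} → proj₁ y ∷ proj₂ y ↭ xs → t * g y ≡ branch (t * m !) (f * m !) (proj₁ y)
      cases {x , rest} p with S? x | T? x
      ... | yes s | _ = cong (t *_) (trans
        (cong length (filter-all firstIn? (All.map⁺ (All.universal (λ _ → hit s) (permutations m rest)))))
        (trans (length-map (x ∷_) (permutations m rest)) (length-permutations m rest (tail-length eq p))))
      ... | no ¬s | yes t∈ = trans (cong (t *_) (cong length (filter-none firstIn?
              (All.map⁺ (All.universal (λ _ → λ { (hit s) → ¬s s ; (skip ¬t _) → ¬t t∈ }) (permutations m rest))))))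
            (ℕ.*-zeroʳ t)
      ... | no ¬s | no ¬t = begin-equality
        t * count firstIn? (map (x ∷_) (permutations m rest))
          ≡⟨ cong (t *_) (count-map firstIn? firstIn? (x ∷_)
               (λ _ → (λ { (hit s) → contradiction s ¬s ; (skip _ f) → f }) , skip ¬t) (permutations m rest)) ⟩
        t * count firstIn? (permutations m rest)
          ≡⟨ ℕ.*-comm t _ ⟩
        count firstIn? (permutations m rest) * t
          ≡⟨ cong (count firstIn? (permutations m rest) *_) (count-rest T? p ¬t) ⟩
        count firstIn? (permutations m rest) * count T? rest
          ≡⟨ count-firstIn m rest (tail-length eq p) ⟩
        count S? rest * m !
          ≡⟨ cong (_* m !) (sym (count-rest S? p ¬s)) ⟩
        f * m ! ∎
        where
        count-rest : {P : Pred A 0ℓ} (P? : Decidable P) → x ∷ rest ↭ xs → ¬ P x → count P? xs ≡ count P? rest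
        count-rest P? q ¬p with P? x | count-↭ P? q
        ... | yes p | _  = contradiction p ¬p
        ... | no  _ | eq = sym eq

-- Ordered fields

module OrderedField (R : CompleteOrderedField) where
  open CompleteOrderedField R
  open CommutativeRing commutativeRing public
    using (+-assoc; +-comm; +-identityˡ; +-identityʳ; -‿inverseˡ; -‿inverseʳ;
           *-assoc; *-comm; *-identityˡ; *-identityʳ; zeroˡ; zeroʳ; distribˡ; distribʳ;
           semiring; commutativeSemiring; ring)
  open RingProperties ring public using (-‿distribˡ-*; -‿involutive; -0#≈0#)
  open SemiringExp semiring public using (^-assocʳ)
  open SemiringMult semiring public using (×-assoc-*; ×-homo-+; ×1-homo-*)

  module Solver = SemiringSolver commutativeSemiring

  totalOrder : TotalOrder 0ℓ 0ℓ 0ℓ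
  totalOrder = record { isTotalOrder = isTotalOrder }

  open TotalOrder totalOrder public using () renaming
    (refl to ≤-refl; reflexive to ≤-reflexive; trans to ≤-trans; antisym to ≤-antisym; total to ≤-total)
  module ≤-Reasoning = PartialOrderReasoning (TotalOrder.poset totalOrder)
  open ≤-Reasoning

  +-mono-≤ : ∀ {x y u v} → x ≤ y → u ≤ v → x + u ≤ y + v
  +-mono-≤ {x} {y} {u} {v} x≤y u≤v = ≤-trans (+-monoˡ-≤ u x≤y)
    (subst₂ _≤_ (+-comm u y) (+-comm v y) (+-monoˡ-≤ y u≤v))

  x+y-y≡x : ∀ x y → x + y + - y ≡ x
  x+y-y≡x x y = trans (+-assoc x y (- y)) (trans (cong (x +_) (-‿inverseʳ y)) (+-identityʳ x))

  x-y+y≡x : ∀ x y → x + - y + y ≡ x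
  x-y+y≡x x y = trans (+-assoc x (- y) y) (trans (cong (x +_) (-‿inverseˡ y)) (+-identityʳ x))

  +-cancelʳ-≤ : ∀ z {x y} → x + z ≤ y + z → x ≤ y
  +-cancelʳ-≤ z {x} {y} le = subst₂ _≤_ (x+y-y≡x x z) (x+y-y≡x y z) (+-monoˡ-≤ (- z) le)

  neg-antimono-≤ : ∀ {x y} → x ≤ y → - y ≤ - x
  neg-antimono-≤ {x} {y} x≤y = +-cancelʳ-≤ (x + y) (subst₂ _≤_ (sym left) (sym right) x≤y)
    where
    left : - y + (x + y) ≡ x
    left = trans (cong (- y +_) (+-comm x y)) (trans (sym (+-assoc (- y) y x)) (trans (cong (_+ x) (-‿inverseˡ y)) (+-identityˡ x)))
    right : - x + (x + y) ≡ y
    right = trans (sym (+-assoc (- x) x y)) (trans (cong (_+ y) (-‿inverseˡ x)) (+-identityˡ y))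

  +-nonNeg : ∀ {x y} → 0# ≤ x → 0# ≤ y → 0# ≤ x + y
  +-nonNeg {x} {y} 0≤x 0≤y = subst (_≤ x + y) (+-identityˡ 0#) (+-mono-≤ 0≤x 0≤y)

  x≤x+y : ∀ x {y} → 0# ≤ y → x ≤ x + y
  x≤x+y x {y} 0≤y = subst (_≤ x + y) (+-identityʳ x) (+-mono-≤ ≤-refl 0≤y)

  *-monoʳ-≤ : ∀ {z} → 0# ≤ z → ∀ {x y} → x ≤ y → x * z ≤ y * z
  *-monoʳ-≤ {z} 0≤z {x} {y} x≤y = +-cancelʳ-≤ (- x * z) (subst₂ _≤_ (sym left) (distribʳ z y (- x)) (*-nonNeg 0≤y-x 0≤z))
    where
    left : x * z + - x * z ≡ 0#
    left = trans (sym (distribʳ z x (- x))) (trans (cong (_* z) (-‿inverseʳ x)) (zeroˡ z))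
    0≤y-x : 0# ≤ y + - x
    0≤y-x = subst (_≤ y + - x) (-‿inverseʳ x) (+-monoˡ-≤ (- x) x≤y)

  *-monoˡ-≤ : ∀ {z} → 0# ≤ z → ∀ {x y} → x ≤ y → z * x ≤ z * y
  *-monoˡ-≤ {z} 0≤z {x} {y} x≤y = subst₂ _≤_ (*-comm x z) (*-comm y z) (*-monoʳ-≤ 0≤z x≤y)

  *-mono-≤ : ∀ {x y u v} → 0# ≤ x → 0# ≤ v → x ≤ y → u ≤ v → x * u ≤ y * v
  *-mono-≤ 0≤x 0≤v x≤y u≤v = ≤-trans (*-monoˡ-≤ 0≤x u≤v) (*-monoʳ-≤ 0≤v x≤y)

  0≤1 : 0# ≤ 1#
  0≤1 with ≤-total 0# 1#
  ... | inj₁ 0≤1 = 0≤1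
  ... | inj₂ 1≤0 = subst (0# ≤_) (trans (sym (-‿distribˡ-* 1# (- 1#))) (trans (cong -_ (*-identityˡ (- 1#))) (-‿involutive 1#)))
    (*-nonNeg 0≤-1 0≤-1)
    where
    0≤-1 : 0# ≤ - 1#
    0≤-1 = subst (_≤ - 1#) -0#≈0# (neg-antimono-≤ 1≤0)

  0<1 : 0# < 1#
  0<1 = 0≤1 , 0≢1

  <⇒≱ : ∀ {x y} → x < y → ¬ (y ≤ x)
  <⇒≱ (x≤y , x≢y) y≤x = x≢y (≤-antisym x≤y y≤x)

  ≰⇒> : ∀ {x y} → ¬ (x ≤ y) → y < x
  ≰⇒> {x} {y} x≰y with ≤-total x y
  ... | inj₁ x≤y = contradiction x≤y x≰y
  ... | inj₂ y≤x = y≤x , λ { refl → x≰y ≤-refl }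

  <-≤-trans : ∀ {x y z} → x < y → y ≤ z → x < z
  <-≤-trans (x≤y , x≢y) y≤z = ≤-trans x≤y y≤z , λ { refl → x≢y (≤-antisym x≤y y≤z) }

  <⇒≢0 : ∀ {x} → 0# < x → x ≢ 0#
  <⇒≢0 (_ , 0≢x) x≡0 = 0≢x (sym x≡0)

  inverse-nonNeg : ∀ {x} → 0# < x → 0# ≤ x ⁻¹
  inverse-nonNeg {x} 0<x with ≤-total 0# (x ⁻¹)
  ... | inj₁ 0≤x⁻¹ = 0≤x⁻¹
  ... | inj₂ x⁻¹≤0 = contradiction
    (subst₂ _≤_ (*-inverseʳ (<⇒≢0 0<x)) (zeroʳ x) (*-monoˡ-≤ (proj₁ 0<x) x⁻¹≤0))
    (<⇒≱ 0<1)

  *-cancelʳ-≤ : ∀ {z} → 0# < z → ∀ {x y} → x * z ≤ y * z → x ≤ y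
  *-cancelʳ-≤ {z} 0<z {x} {y} le = subst₂ _≤_ (cancel x) (cancel y) (*-monoʳ-≤ (inverse-nonNeg 0<z) le)
    where
    cancel : ∀ w → w * z * z ⁻¹ ≡ w
    cancel w = trans (*-assoc w z (z ⁻¹)) (trans (cong (w *_) (*-inverseʳ (<⇒≢0 0<z))) (*-identityʳ w))

  *-pos : ∀ {x y} → 0# < x → 0# < y → 0# < x * y
  *-pos {x} {y} 0<x 0<y = *-nonNeg (proj₁ 0<x) (proj₁ 0<y) ,
    λ 0≡xy → <⇒≢0 0<x (≤-antisym (*-cancelʳ-≤ 0<y (≤-reflexive (trans (sym 0≡xy) (sym (zeroˡ y))))) (proj₁ 0<x))

  inverse-pos : ∀ {x} → 0# < x → 0# < x ⁻¹
  inverse-pos {x} 0<x = inverse-nonNeg 0<x ,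
    λ 0≡x⁻¹ → 0≢1 (trans (sym (zeroʳ x)) (trans (cong (x *_) 0≡x⁻¹) (*-inverseʳ (<⇒≢0 0<x))))

  fromℕ-nonNeg : ∀ n → 0# ≤ fromℕ n
  fromℕ-nonNeg zero    = ≤-refl
  fromℕ-nonNeg (suc n) = +-nonNeg 0≤1 (fromℕ-nonNeg n)

  fromℕ-+ : ∀ m n → fromℕ (m ℕ.+ n) ≡ fromℕ m + fromℕ n
  fromℕ-+ = ×-homo-+ 1#

  fromℕ-* : ∀ m n → fromℕ (m ℕ.* n) ≡ fromℕ m * fromℕ n
  fromℕ-* = ×1-homo-*

  fromℕ-1 : fromℕ 1 ≡ 1#
  fromℕ-1 = +-identityʳ 1#

  fromℕ-^ : ∀ m n → fromℕ (m ℕ.^ n) ≡ fromℕ m ^ n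
  fromℕ-^ m zero    = fromℕ-1
  fromℕ-^ m (suc n) = trans (fromℕ-* m (m ℕ.^ n)) (cong (fromℕ m *_) (fromℕ-^ m n))

  fromℕ-mono : ∀ {m n} → m ℕ.≤ n → fromℕ m ≤ fromℕ n
  fromℕ-mono {n = n} z≤n = fromℕ-nonNeg n
  fromℕ-mono (s≤s m≤n) = +-mono-≤ ≤-refl (fromℕ-mono m≤n)

  fromℕ-pos : ∀ {n} → 1 ℕ.≤ n → 0# < fromℕ n
  fromℕ-pos {n} 1≤n = <-≤-trans 0<1 (subst (_≤ fromℕ n) fromℕ-1 (fromℕ-mono 1≤n))

  ^-nonNeg : ∀ {x} n → 0# ≤ x → 0# ≤ x ^ n
  ^-nonNeg zero    0≤x = 0≤1
  ^-nonNeg (suc n) 0≤x = *-nonNeg 0≤x (^-nonNeg n 0≤x)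

  ^-pos : ∀ {x} n → 0# < x → 0# < x ^ n
  ^-pos zero    0<x = 0<1
  ^-pos (suc n) 0<x = *-pos 0<x (^-pos n 0<x)

  ^-monoˡ-≤ : ∀ {x y} n → 0# ≤ x → x ≤ y → x ^ n ≤ y ^ n
  ^-monoˡ-≤ zero    0≤x x≤y = ≤-refl
  ^-monoˡ-≤ (suc n) 0≤x x≤y = *-mono-≤ 0≤x (^-nonNeg n (≤-trans 0≤x x≤y)) x≤y (^-monoˡ-≤ n 0≤x x≤y)

  1^ : ∀ n → 1# ^ n ≡ 1#
  1^ zero    = refl
  1^ (suc n) = trans (*-identityˡ _) (1^ n)

  1≤^ : ∀ {x} n → 1# ≤ x → 1# ≤ x ^ n
  1≤^ {x} n 1≤x = subst (_≤ x ^ n) (1^ n) (^-monoˡ-≤ n 0≤1 1≤x)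

  ^-monoʳ-≤ : ∀ {x m n} → 1# ≤ x → m ℕ.≤ n → x ^ m ≤ x ^ n
  ^-monoʳ-≤ {n = n} 1≤x z≤n   = 1≤^ n 1≤x
  ^-monoʳ-≤ 1≤x (s≤s m≤n) = *-monoˡ-≤ (≤-trans 0≤1 1≤x) (^-monoʳ-≤ 1≤x m≤n)

  ^-distribʳ : ∀ x y n → (x * y) ^ n ≡ x ^ n * y ^ n
  ^-distribʳ x y zero    = sym (*-identityˡ 1#)
  ^-distribʳ x y (suc n) = trans (cong (x * y *_) (^-distribʳ x y n)) (interchange x y (x ^ n) (y ^ n))
    where
    interchange : ∀ x y p q → (x * y) * (p * q) ≡ (x * p) * (y * q)
    interchange = Solver.solve 4 (λ x y p q → ((x :* y) :* (p :* q)) := ((x :* p) :* (y :* q))) refl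
      where open Solver using (_:*_; _:=_)

  ^-monoˡ-< : ∀ {x y} n → 0# ≤ x → x < y → x ^ suc n < y ^ suc n
  ^-monoˡ-< {x} {y} n 0≤x x<y = ^-monoˡ-≤ (suc n) 0≤x (proj₁ x<y) , λ eq →
    <⇒≱ x<y (*-cancelʳ-≤ (^-pos n (≤-<-trans 0≤x x<y))
      (subst (_≤ x * y ^ n) eq (*-monoˡ-≤ 0≤x (^-monoˡ-≤ n 0≤x (proj₁ x<y)))))
    where
    ≤-<-trans : ∀ {x y z} → x ≤ y → y < z → x < z
    ≤-<-trans x≤y (y≤z , y≢z) = ≤-trans x≤y y≤z , λ { refl → y≢z (≤-antisym y≤z x≤y) }

-- The exponential series and the logarithm

module Exponential (lem : ExcludedMiddle 0ℓ) (R : CompleteOrderedField) where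
  open Theory lem R
  open OrderedField R
  open ≤-Reasoning
  open SemiringSum semiring using (sum-cong-≋; *-distribʳ-sum; *-distribˡ-sum; ∑-distrib-+)
  module Binomial = BinomialTheorem commutativeSemiring

  ≮⇒≥ : ∀ {x y} → ¬ (x < y) → y ≤ x
  ≮⇒≥ {x} {y} x≮y with ≤-total y x
  ... | inj₁ y≤x = y≤x
  ... | inj₂ x≤y with lem {P = x ≡ y}
  ...   | yes refl = ≤-refl
  ...   | no  x≢y  = contradiction (x≤y , x≢y) x≮y

  -- This replaces the extraction of roots when 2 N-th powers are compared at the end.
  ^-cancel-≤ : ∀ {x y} n → 0# ≤ y → x ^ suc n ≤ y ^ suc n → x ≤ y
  ^-cancel-≤ n 0≤y x^≤y^ = ≮⇒≥ λ y<x → <⇒≱ (^-monoˡ-< n 0≤y y<x) x^≤y^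

  -- Otherwise the naturals would have a supremum S; as n + 1 ≤ S for every n, already S - 1 would
  -- be an upper bound.
  archimedean : ∀ x → ∃ λ n → x ≤ fromℕ n
  archimedean x with lem {P = ∃ λ n → x ≤ fromℕ n}
  ... | yes p = p
  ... | no ¬p = contradiction (+-cancelʳ-≤ S (subst₂ _≤_ (+-comm S 1#) (sym (+-identityˡ S)) S+1≤S)) (<⇒≱ 0<1)
    where
    Naturals : ℝ → Set
    Naturals y = ∃ λ n → y ≡ fromℕ n
    inhabited : ∃ Naturals
    inhabited = 0# , 0 , refl
    bounded : ∃ (UpperBound Naturals)
    bounded = x , λ { (n , refl) → proj₁ (≰⇒> λ x≤n → ¬p (n , x≤n)) }
    S : ℝ
    S = ⨆ Naturals
    S≤S-1 : S ≤ S + - 1#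
    S≤S-1 = ⨆-least Naturals inhabited bounded λ { (n , refl) →
      subst (_≤ S + - 1#) (trans (cong (_+ - 1#) (+-comm 1# (fromℕ n))) (x+y-y≡x (fromℕ n) 1#))
        (+-monoˡ-≤ (- 1#) (⨆-upper Naturals inhabited bounded (suc n , refl))) }
    S+1≤S : S + 1# ≤ S
    S+1≤S = subst (S + 1# ≤_) (x-y+y≡x S 1#)
              (+-monoˡ-≤ 1# S≤S-1)

  Σ< : ℕ → (ℕ → ℝ) → ℝ
  Σ< m f = sum {m} λ k → f (toℕ k)

  Σ<-cong : ∀ m {f g : ℕ → ℝ} → (∀ k → k ℕ.< m → f k ≡ g k) → Σ< m f ≡ Σ< m g
  Σ<-cong m f≡g = sum-cong-≋ {m} λ k → f≡g (toℕ k) (Fin.toℕ<n k)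

  Σ<-mono : ∀ m {f g : ℕ → ℝ} → (∀ k → f k ≤ g k) → Σ< m f ≤ Σ< m g
  Σ<-mono zero    f≤g = ≤-refl
  Σ<-mono (suc m) f≤g = +-mono-≤ (f≤g 0) (Σ<-mono m (f≤g ∘ suc))

  Σ<-nonNeg : ∀ m {f : ℕ → ℝ} → (∀ k → 0# ≤ f k) → 0# ≤ Σ< m f
  Σ<-nonNeg zero    0≤f = ≤-refl
  Σ<-nonNeg (suc m) 0≤f = +-nonNeg (0≤f 0) (Σ<-nonNeg m (0≤f ∘ suc))

  Σ<-suc-≥ : ∀ m {f : ℕ → ℝ} → (∀ k → 0# ≤ f k) → Σ< m f ≤ Σ< (suc m) f
  Σ<-suc-≥ zero    0≤f = +-nonNeg (0≤f 0) ≤-refl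
  Σ<-suc-≥ (suc m) 0≤f = +-mono-≤ ≤-refl (Σ<-suc-≥ m (0≤f ∘ suc))

  convolution : (ℕ → ℝ) → (ℕ → ℝ) → ℕ → ℝ
  convolution a b n = Σ< (suc n) λ k → a k * b (n ℕ.∸ k)

  -- The left side sums a i b j over the triangle i + j < m, the right side over the whole square,
  -- and all terms are nonnegative. The induction peels off the row of `a 0`.
  Σ<-convolution : ∀ m {a b : ℕ → ℝ} → (∀ k → 0# ≤ a k) → (∀ k → 0# ≤ b k) →
                   Σ< m (convolution a b) ≤ Σ< m a * Σ< m b
  Σ<-convolution zero    {a} {b} 0≤a 0≤b = ≤-reflexive (sym (zeroˡ 0#))
  Σ<-convolution (suc m) {a} {b} 0≤a 0≤b = begin
    a 0 * b 0 + 0# + Σ< m (λ n → a 0 * b (suc n) + convolution (a ∘ suc) b n)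
      ≡⟨ cong₂ _+_ (+-identityʳ (a 0 * b 0)) (∑-distrib-+ {m} (λ n → a 0 * b (suc (toℕ n))) (λ n → convolution (a ∘ suc) b (toℕ n))) ⟩
    a 0 * b 0 + (Σ< m (λ n → a 0 * b (suc n)) + Σ< m (convolution (a ∘ suc) b))
      ≡⟨ cong (λ z → a 0 * b 0 + (z + Σ< m (convolution (a ∘ suc) b))) (sym (*-distribˡ-sum {m} (a 0) (λ n → b (suc (toℕ n))))) ⟩
    a 0 * b 0 + (a 0 * Σ< m (b ∘ suc) + Σ< m (convolution (a ∘ suc) b))
      ≡⟨ sym (+-assoc _ _ _) ⟩
    a 0 * b 0 + a 0 * Σ< m (b ∘ suc) + Σ< m (convolution (a ∘ suc) b)
      ≡⟨ cong (_+ Σ< m (convolution (a ∘ suc) b)) (sym (distribˡ (a 0) (b 0) _)) ⟩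
    a 0 * Σ< (suc m) b + Σ< m (convolution (a ∘ suc) b)
      ≤⟨ +-mono-≤ ≤-refl (Σ<-convolution m (0≤a ∘ suc) 0≤b) ⟩
    a 0 * Σ< (suc m) b + Σ< m (a ∘ suc) * Σ< m b
      ≤⟨ +-mono-≤ ≤-refl (*-monoˡ-≤ (Σ<-nonNeg m (0≤a ∘ suc)) (Σ<-suc-≥ m 0≤b)) ⟩
    a 0 * Σ< (suc m) b + Σ< m (a ∘ suc) * Σ< (suc m) b
      ≡⟨ sym (distribʳ (Σ< (suc m) b) (a 0) _) ⟩
    Σ< (suc m) a * Σ< (suc m) b ∎

  term : ℝ → ℕ → ℝ
  term x k = x ^ k ÷ fromℕ (k !)

  !-pos : ∀ k → 0# < fromℕ (k !)
  !-pos k = fromℕ-pos (ℕ.1≤n! k)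

  term-nonNeg : ∀ {x} → 0# ≤ x → ∀ k → 0# ≤ term x k
  term-nonNeg 0≤x k = *-nonNeg (^-nonNeg k 0≤x) (inverse-nonNeg (!-pos k))

  nCk*k!*[n∸k]! : ∀ {n k} → k ℕ.≤ n → (n C k) ℕ.* (k ! ℕ.* (n ℕ.∸ k) !) ≡ n !
  nCk*k!*[n∸k]! {n} {k} k≤n = trans
    (cong (ℕ._* (k ! ℕ.* (n ℕ.∸ k) !)) (nCk≡n!/k![n-k]! k≤n))
    (m/n*n≡m {{_}} (k![n∸k]!∣n! k≤n))

  term-binomial : ∀ x y n → term (x + y) n ≡ convolution (term x) (term y) n
  term-binomial x y n = trans (cong (_* fromℕ (n !) ⁻¹) (Binomial.theorem n x y))
    (trans (*-distribʳ-sum {suc n} (fromℕ (n !) ⁻¹) (Binomial.binomialTerm x y n))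
           (sum-cong-≋ {suc n} λ i → termwise (toℕ i) (ℕ.≤-pred (Fin.toℕ<n i))))
    where
    termwise : ∀ k → k ℕ.≤ n → ((n C k) · (x ^ k * y ^ (n ℕ.∸ k))) * fromℕ (n !) ⁻¹ ≡ term x k * term y (n ℕ.∸ k)
    termwise k k≤n = begin-equality
      (c · (p * q)) * N ⁻¹
        ≡⟨ cong (_* N ⁻¹) (trans (cong (c ·_) (sym (*-identityˡ (p * q)))) (sym (×-assoc-* c 1# (p * q)))) ⟩
      (fromℕ c * (p * q)) * N ⁻¹
        -- Two factors equal to 1 are inserted so that the binomial coefficient can be regrouped
        -- with k ! and (n - k) ! into n !.
        ≡⟨ sym (trans (cong₂ _*_ refl (cong₂ _*_ (*-inverseʳ (<⇒≢0 (!-pos k))) (*-inverseʳ (<⇒≢0 (!-pos j)))))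
             (trans (cong (fromℕ c * (p * q) * N ⁻¹ *_) (*-identityˡ 1#)) (*-identityʳ _))) ⟩
      fromℕ c * (p * q) * N ⁻¹ * ((a * a ⁻¹) * (b * b ⁻¹))
        ≡⟨ Solver.solve 8 (λ c p q n a a′ b b′ →
             c :* (p :* q) :* n :* ((a :* a′) :* (b :* b′)) := c :* (a :* b) :* n :* ((p :* a′) :* (q :* b′)))
             refl (fromℕ c) p q (N ⁻¹) a (a ⁻¹) b (b ⁻¹) ⟩
      fromℕ c * (a * b) * N ⁻¹ * ((p * a ⁻¹) * (q * b ⁻¹))
        ≡⟨ cong (λ m → m * N ⁻¹ * ((p * a ⁻¹) * (q * b ⁻¹))) cab≡N ⟩
      N * N ⁻¹ * ((p * a ⁻¹) * (q * b ⁻¹))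
        ≡⟨ trans (cong (_* ((p * a ⁻¹) * (q * b ⁻¹))) (*-inverseʳ (<⇒≢0 (!-pos n)))) (*-identityˡ _) ⟩
      term x k * term y j ∎
      where
      open Solver using (_:*_; _:=_)
      j = n ℕ.∸ k
      c = n C k
      p = x ^ k
      q = y ^ j
      N = fromℕ (n !)
      a = fromℕ (k !)
      b = fromℕ (j !)
      cab≡N : fromℕ c * (a * b) ≡ N
      cab≡N = trans (cong (fromℕ c *_) (sym (fromℕ-* (k !) (j !))))
              (trans (sym (fromℕ-* c (k ! ℕ.* j !))) (cong fromℕ (nCk*k!*[n∸k]! k≤n)))

  -- The truncated Cauchy product dominates the truncation of the product. The bounds on multiples
  -- of an exponent below rest on this one-sided law.
  expPartialSum-+ : ∀ {x y} m → 0# ≤ x → 0# ≤ y →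
                    expPartialSum (x + y) m ≤ expPartialSum x m * expPartialSum y m
  expPartialSum-+ {x} {y} m 0≤x 0≤y = subst (_≤ expPartialSum x m * expPartialSum y m)
    (sym (Σ<-cong m λ n _ → term-binomial x y n))
    (Σ<-convolution m (term-nonNeg 0≤x) (term-nonNeg 0≤y))

  ½ : ℝ
  ½ = fromℕ 2 ⁻¹

  0<2 : 0# < fromℕ 2
  0<2 = fromℕ-pos {2} (s≤s z≤n)

  0<½ : 0# < ½
  0<½ = inverse-pos 0<2

  1⁻¹ : 1# ⁻¹ ≡ 1#
  1⁻¹ = trans (sym (*-identityˡ _)) (*-inverseʳ (<⇒≢0 0<1))

  inverse-≤1 : ∀ {x} → 1# ≤ x → x ⁻¹ ≤ 1#
  inverse-≤1 {x} 1≤x = subst₂ _≤_ (*-identityˡ (x ⁻¹)) (*-inverseʳ (<⇒≢0 0<x)) (*-monoʳ-≤ (inverse-nonNeg 0<x) 1≤x)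
    where
    0<x : 0# < x
    0<x = <-≤-trans 0<1 1≤x

  geometric-≤2 : ∀ m → Σ< m (½ ^_) ≤ fromℕ 2
  geometric-≤2 zero    = proj₁ 0<2
  geometric-≤2 (suc m) = begin
    1# + Σ< m (λ k → ½ * ½ ^ k) ≡⟨ cong (1# +_) (sym (*-distribˡ-sum {m} ½ (λ k → ½ ^ toℕ k))) ⟩
    1# + ½ * Σ< m (½ ^_)        ≤⟨ +-mono-≤ ≤-refl (*-monoˡ-≤ (proj₁ 0<½) (geometric-≤2 m)) ⟩
    1# + ½ * fromℕ 2
      ≡⟨ cong (1# +_) (trans (*-comm ½ (fromℕ 2)) (trans (*-inverseʳ (<⇒≢0 0<2)) (sym fromℕ-1))) ⟩
    fromℕ 2                     ∎

  -- Dropping the factorials leaves the geometric series. The point ½ serves twice: its multiples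
  -- bound the series everywhere, and exp ½ ≤ 2 makes logarithms positive.
  expPartialSum-½ : ∀ m → expPartialSum ½ m ≤ fromℕ 2
  expPartialSum-½ m = ≤-trans (Σ<-mono m λ k → subst (term ½ k ≤_) (*-identityʳ (½ ^ k))
      (*-monoˡ-≤ (^-nonNeg k (proj₁ 0<½)) (inverse-≤1 (subst (_≤ fromℕ (k !)) fromℕ-1 (fromℕ-mono (ℕ.1≤n! k))))))
    (geometric-≤2 m)

  expPartialSum-nonNeg : ∀ {x} m → 0# ≤ x → 0# ≤ expPartialSum x m
  expPartialSum-nonNeg m 0≤x = Σ<-nonNeg m (term-nonNeg 0≤x)

  expPartialSum-mono : ∀ {x y} m → 0# ≤ x → x ≤ y → expPartialSum x m ≤ expPartialSum y m
  expPartialSum-mono m 0≤x x≤y = Σ<-mono m λ k →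
    *-monoʳ-≤ (inverse-nonNeg (!-pos k)) (^-monoˡ-≤ k 0≤x x≤y)

  expPartialSum-0 : ∀ m → expPartialSum 0# m ≤ 1#
  expPartialSum-0 zero    = 0≤1
  expPartialSum-0 (suc m) = ≤-reflexive (trans
    (cong₂ _+_ (trans (*-identityˡ _) (trans (cong _⁻¹ fromℕ-1) 1⁻¹)) (tail m))
    (+-identityʳ 1#))
    where
    tail : ∀ m → Σ< m (term 0# ∘ suc) ≡ 0#
    tail m = trans (Σ<-cong m {g = λ _ → 0#} λ k _ → trans (cong (_* fromℕ (suc k !) ⁻¹) (zeroˡ (0# ^ k))) (zeroˡ _)) (zeros m)
      where
      zeros : ∀ m → Σ< m (λ _ → 0#) ≡ 0#
      zeros zero    = refl
      zeros (suc m) = trans (+-identityˡ _) (zeros m)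

  expPartialSum-· : ∀ {x} m n → 0# ≤ x → expPartialSum (n · x) (suc m) ≤ expPartialSum x (suc m) ^ n
  expPartialSum-· m zero    0≤x = expPartialSum-0 (suc m)
  expPartialSum-· {x} m (suc n) 0≤x = ≤-trans (expPartialSum-+ (suc m) 0≤x (·-nonNeg n))
    (*-monoˡ-≤ (expPartialSum-nonNeg (suc m) 0≤x) (expPartialSum-· m n 0≤x))
    where
    ·-nonNeg : ∀ n → 0# ≤ n · x
    ·-nonNeg zero    = ≤-refl
    ·-nonNeg (suc n) = +-nonNeg 0≤x (·-nonNeg n)

  ·-* : ∀ n x → n · x ≡ fromℕ n * x
  ·-* n x = trans (cong (n ·_) (sym (*-identityˡ x))) (sym (×-assoc-* n 1# x))

  -- x is at most n / 2 for some n, where the partial sums are at most 2 ^ n.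
  expPartialSum-bounded : ∀ {x} → 0# ≤ x → ∃ λ b → ∀ m → expPartialSum x m ≤ b
  expPartialSum-bounded {x} 0≤x = fromℕ 2 ^ n , λ m → begin
    expPartialSum x m           ≤⟨ Σ<-suc-≥ m (term-nonNeg 0≤x) ⟩
    expPartialSum x (suc m)     ≤⟨ expPartialSum-mono (suc m) 0≤x x≤n½ ⟩
    expPartialSum (n · ½) (suc m) ≤⟨ expPartialSum-· m n (proj₁ 0<½) ⟩
    expPartialSum ½ (suc m) ^ n ≤⟨ ^-monoˡ-≤ n (expPartialSum-nonNeg (suc m) (proj₁ 0<½)) (expPartialSum-½ (suc m)) ⟩
    fromℕ 2 ^ n                 ∎
    where
    n : ℕ
    n = proj₁ (archimedean (x * fromℕ 2))
    x≤n½ : x ≤ n · ½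
    x≤n½ = *-cancelʳ-≤ 0<2 (begin
      x * fromℕ 2         ≤⟨ proj₂ (archimedean (x * fromℕ 2)) ⟩
      fromℕ n             ≡⟨ sym (*-identityʳ _) ⟩
      fromℕ n * 1#        ≡⟨ cong (fromℕ n *_) (sym (trans (*-comm ½ (fromℕ 2)) (*-inverseʳ (<⇒≢0 0<2)))) ⟩
      fromℕ n * (½ * fromℕ 2) ≡⟨ sym (*-assoc _ _ _) ⟩
      fromℕ n * ½ * fromℕ 2 ≡⟨ cong (_* fromℕ 2) (sym (·-* n ½)) ⟩
      n · ½ * fromℕ 2     ∎)

  module _ {x : ℝ} (0≤x : 0# ≤ x) where
    private
      PartialSums : ℝ → Set
      PartialSums y = ∃ λ m → y ≡ expPartialSum x m

      inhabited : ∃ PartialSums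
      inhabited = _ , 0 , refl

      bounded : ∃ (UpperBound PartialSums)
      bounded = proj₁ (expPartialSum-bounded 0≤x) , λ { (m , refl) → proj₂ (expPartialSum-bounded 0≤x) m }

    expPartialSum-≤ : ∀ m → expPartialSum x m ≤ expSeries x
    expPartialSum-≤ m = ⨆-upper PartialSums inhabited bounded (m , refl)

    expSeries-least : ∀ {b} → (∀ m → expPartialSum x m ≤ b) → expSeries x ≤ b
    expSeries-least ub = ⨆-least PartialSums inhabited bounded λ { (m , refl) → ub m }

  1+x≤expSeries : ∀ {x} → 0# ≤ x → 1# + x ≤ expSeries x
  1+x≤expSeries {x} 0≤x = ≤-trans (≤-reflexive (sym two-terms)) (expPartialSum-≤ 0≤x 2)
    where
    two-terms : expPartialSum x 2 ≡ 1# + x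
    two-terms = cong₂ _+_ (trans (*-identityˡ _) (trans (cong _⁻¹ fromℕ-1) 1⁻¹))
      (trans (+-identityʳ _) (trans (cong₂ _*_ (*-identityʳ x) (trans (cong _⁻¹ fromℕ-1) 1⁻¹)) (*-identityʳ x)))

  1≤expSeries : ∀ {x} → 0# ≤ x → 1# ≤ expSeries x
  1≤expSeries {x} 0≤x = ≤-trans (x≤x+y 1# 0≤x) (1+x≤expSeries 0≤x)

  expSeries-0 : expSeries 0# ≡ 1#
  expSeries-0 = ≤-antisym (expSeries-least ≤-refl expPartialSum-0) (1≤expSeries ≤-refl)

  expSeries-mono : ∀ {x y} → 0# ≤ x → x ≤ y → expSeries x ≤ expSeries y
  expSeries-mono 0≤x x≤y = expSeries-least 0≤x λ m →
    ≤-trans (expPartialSum-mono m 0≤x x≤y) (expPartialSum-≤ (≤-trans 0≤x x≤y) m)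

  expSeries-· : ∀ {x} n → 0# ≤ x → expSeries (fromℕ n * x) ≤ expSeries x ^ n
  expSeries-· {x} n 0≤x = expSeries-least (*-nonNeg (fromℕ-nonNeg n) 0≤x) λ m → begin
    expPartialSum (fromℕ n * x) m       ≤⟨ Σ<-suc-≥ m (term-nonNeg (*-nonNeg (fromℕ-nonNeg n) 0≤x)) ⟩
    expPartialSum (fromℕ n * x) (suc m) ≡⟨ cong (λ y → expPartialSum y (suc m)) (sym (·-* n x)) ⟩
    expPartialSum (n · x) (suc m)       ≤⟨ expPartialSum-· m n 0≤x ⟩
    expPartialSum x (suc m) ^ n
      ≤⟨ ^-monoˡ-≤ n (expPartialSum-nonNeg (suc m) 0≤x) (expPartialSum-≤ 0≤x (suc m)) ⟩
    expSeries x ^ n                     ∎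

  exp-nonNeg : ∀ {x} → 0# ≤ x → exp x ≡ expSeries x
  exp-nonNeg {x} 0≤x with 0# ≤? x
  ... | yes _   = refl
  ... | no  0≰x = contradiction 0≤x 0≰x

  exp-neg : ∀ {x} → 0# ≤ x → exp (- x) ≡ expSeries x ⁻¹
  exp-neg {x} 0≤x with 0# ≤? (- x)
  ... | no  _    = cong (λ y → expSeries y ⁻¹) (-‿involutive x)
  -- Here `exp` evaluates the series at - x instead of inverting it; this forces x = 0, where both
  -- values are 1.
  ... | yes 0≤-x = trans (cong expSeries (trans (cong -_ x≡0) -0#≈0#))
                     (trans expSeries-0 (trans (sym 1⁻¹) (cong _⁻¹ (trans (sym expSeries-0) (cong expSeries (sym x≡0))))))
    where
    x≡0 : x ≡ 0#
    x≡0 = ≤-antisym (subst₂ _≤_ (-‿involutive x) -0#≈0# (neg-antimono-≤ 0≤-x)) 0≤x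

  module _ {s : ℕ} (1≤s : 1 ℕ.≤ s) where
    private
      Below : ℝ → Set
      Below y = exp y ≤ fromℕ s

      0-below : Below 0#
      0-below = subst (_≤ fromℕ s) (sym (trans (exp-nonNeg ≤-refl) (trans expSeries-0 (sym fromℕ-1)))) (fromℕ-mono 1≤s)

      bounded : ∃ (UpperBound Below)
      bounded = fromℕ s , λ {y} below → bound y below (≤-total 0# y)
        where
        bound : ∀ y → Below y → 0# ≤ y ⊎ y ≤ 0# → y ≤ fromℕ s
        bound y below (inj₂ y≤0) = ≤-trans y≤0 (fromℕ-nonNeg s)
        bound y below (inj₁ 0≤y) = begin
          y           ≤⟨ x≤x+y y 0≤1 ⟩
          y + 1#      ≡⟨ +-comm y 1# ⟩
          1# + y      ≤⟨ 1+x≤expSeries 0≤y ⟩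
          expSeries y ≡⟨ sym (exp-nonNeg 0≤y) ⟩
          exp y       ≤⟨ below ⟩
          fromℕ s     ∎

    exp≤⇒≤ln : ∀ {y} → exp y ≤ fromℕ s → y ≤ ln (fromℕ s)
    exp≤⇒≤ln = ⨆-upper Below (0# , 0-below) bounded

    ln-nonNeg : 0# ≤ ln (fromℕ s)
    ln-nonNeg = exp≤⇒≤ln 0-below

  -- The witness is ½: from exp ½ ≤ 2 ≤ s follows ln s ≥ ½.
  ln-pos : ∀ {s} → 2 ℕ.≤ s → 0# < ln (fromℕ s)
  ln-pos {s} 2≤s = <-≤-trans 0<½ (exp≤⇒≤ln (ℕ.≤-trans (s≤s z≤n) 2≤s) (begin
    exp ½       ≡⟨ exp-nonNeg (proj₁ 0<½) ⟩
    expSeries ½ ≤⟨ expSeries-least (proj₁ 0<½) expPartialSum-½ ⟩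
    fromℕ 2     ≤⟨ fromℕ-mono 2≤s ⟩
    fromℕ s     ∎))

  -- Weaker than exp (ln s) ≡ s, but needs no continuity: 2 ln s > ln s is not
  -- in the set of which ln s is the supremum.
  ≤expSeries-2ln : ∀ {s} → 1 ℕ.≤ s → fromℕ s ≤ expSeries (ln (fromℕ s) + ln (fromℕ s))
  -- For s = 1 there is no gap between ln s and 2 ln s to exploit, but the exponential is at least 1
  -- anyway.
  ≤expSeries-2ln {suc zero} 1≤s = subst (_≤ expSeries (ln (fromℕ 1) + ln (fromℕ 1))) (sym fromℕ-1)
    (1≤expSeries (+-nonNeg (ln-nonNeg 1≤s) (ln-nonNeg 1≤s)))
  ≤expSeries-2ln {s@(suc (suc _))} 1≤s with ≤-total (fromℕ s) (expSeries (ln (fromℕ s) + ln (fromℕ s)))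
  ... | inj₁ s≤E = s≤E
  ... | inj₂ E≤s = contradiction
    (+-cancelʳ-≤ L (subst (L + L ≤_) (sym (+-identityˡ L)) (exp≤⇒≤ln 1≤s
      (subst (_≤ fromℕ s) (sym (exp-nonNeg (+-nonNeg 0≤L 0≤L))) E≤s))))
    (<⇒≱ (ln-pos {s} (s≤s (s≤s z≤n))))
    where
    L : ℝ
    L = ln (fromℕ s)
    0≤L : 0# ≤ L
    0≤L = ln-nonNeg 1≤s

-- Partitions and distributions

module _ {A : Set} where

  -- The additional last index stands for "no entry satisfies `P`".
  firstIndex : {P : Pred A 0ℓ} → Decidable P → (xs : List A) → Fin (suc (length xs))
  firstIndex P? []       = zero
  firstIndex P? (x ∷ xs) = if does (P? x) then zero else suc (firstIndex P? xs)

  -- Equal indices name one common entry; the `Any` hypothesis excludes the default index, which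
  -- carries no information.
  firstIndex-common : {P Q : Pred A 0ℓ} (P? : Decidable P) (Q? : Decidable Q) {xs : List A} →
                      firstIndex P? xs ≡ firstIndex Q? xs → Any P xs → ∃ λ x → x ∈ˡ xs × P x × Q x
  firstIndex-common P? Q? {x ∷ xs} eq any with P? x | Q? x | any
  ... | yes p | yes q | _        = x , here refl , p , q
  ... | no ¬p | no  _ | here p   = contradiction p ¬p
  ... | no  _ | no  _ | there ps with firstIndex-common P? Q? {xs} (Fin.suc-injective eq) ps
  ...   | y , y∈xs , p , q = y , there y∈xs , p , q
  firstIndex-common P? Q? {x ∷ xs} () any | yes _ | no _ | _

  -- Both predicates lie between S and T. Neither can hold before the first entry of T, and both
  -- hold there because it is in S, so both searches stop at it.
  firstIndex-FirstIn : {S T P Q : Pred A 0ℓ} (S? : Decidable S) (T? : Decidable T) (S⊆T : ∀ {x} → S x → T x)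
                       (P? : Decidable P) (Q? : Decidable Q) →
                       (∀ {x} → S x → P x) → (∀ {x} → S x → Q x) → (∀ {x} → P x → T x) → (∀ {x} → Q x → T x) →
                       ∀ {xs} → FirstIn S? T? S⊆T xs → firstIndex P? xs ≡ firstIndex Q? xs
  firstIndex-FirstIn S? T? S⊆T P? Q? S⊆P S⊆Q P⊆T Q⊆T {x ∷ xs} (hit s) with P? x | Q? x
  ... | yes _ | yes _ = refl
  ... | no ¬p | _     = contradiction (S⊆P s) ¬p
  ... | yes _ | no ¬q = contradiction (S⊆Q s) ¬q
  firstIndex-FirstIn S? T? S⊆T P? Q? S⊆P S⊆Q P⊆T Q⊆T {x ∷ xs} (skip ¬t first) with P? x | Q? x
  ... | no  _ | no  _ = cong suc (firstIndex-FirstIn S? T? S⊆T P? Q? S⊆P S⊆Q P⊆T Q⊆T first)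
  ... | yes p | _     = contradiction (P⊆T p) ¬t
  ... | no  _ | yes q = contradiction (Q⊆T q) ¬t

module _ {n : ℕ} where

  ∈-tabulate-does⁺ : {P : Pred (Fin n) 0ℓ} (P? : Decidable P) {u : Fin n} → P u → u ∈ tabulate (does ∘ P?)
  ∈-tabulate-does⁺ P? {u} p = lookup⇒[]= u _ (trans (lookup∘tabulate (does ∘ P?) u) (dec-true (P? u) p))

  ∈-tabulate-does⁻ : {P : Pred (Fin n) 0ℓ} (P? : Decidable P) {u : Fin n} → u ∈ tabulate (does ∘ P?) → P u
  ∈-tabulate-does⁻ P? {u} u∈ with P? u | trans (sym (lookup∘tabulate (does ∘ P?) u)) ([]=⇒lookup u∈)
  ... | yes p | _ = p
  ... | no  _ | ()

module Partitions (lem : ExcludedMiddle 0ℓ) (R : CompleteOrderedField) where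
  open Theory lem R
  open OrderedField R

  module _ {n m : ℕ} (label : Fin n → Fin m) where

    fibre : Fin m → Subset n
    fibre i = tabulate (does ∘ λ u → label u Fin.≟ i)

    ∈-fibre⁺ : ∀ {u i} → label u ≡ i → u ∈ fibre i
    ∈-fibre⁺ {i = i} = ∈-tabulate-does⁺ λ u → label u Fin.≟ i

    ∈-fibre⁻ : ∀ {u i} → u ∈ fibre i → label u ≡ i
    ∈-fibre⁻ {i = i} = ∈-tabulate-does⁻ λ u → label u Fin.≟ i

    fibrePartition : Partition n
    fibrePartition = record
      { clusters = filter nonempty? (List.tabulate fibre)
      ; nonempty = All.all-filter nonempty? (List.tabulate fibre)
      ; disjoint = AllPairs.filter⁺ nonempty? (AllPairs.tabulate⁺ λ {i} {j} i≢j (u , u∈) →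
          let u∈i , u∈j = x∈p∩q⁻ (fibre i) (fibre j) u∈ in i≢j (trans (sym (∈-fibre⁻ u∈i)) (∈-fibre⁻ u∈j)))
      ; covers   = λ v → Any.map (λ { refl → ∈-fibre⁺ refl })
          (∈-filter⁺ nonempty? (∈-tabulate⁺ {f = fibre} (label v)) (v , ∈-fibre⁺ refl))
      }

    -- `clusterOf` follows a membership proof into the filtered list; this recovers a label for
    -- whichever entry it finds.
    clusters-fibres : All (λ C → ∃ λ i → C ≡ fibre i) (clusters fibrePartition)
    clusters-fibres = All.filter⁺ nonempty? (All.tabulate⁺ λ i → i , refl)

    ∈-clusterOf : ∀ {u z} → label u ≡ label z → u ∈ clusterOf fibrePartition z
    ∈-clusterOf {u} {z} eq with All.lookupAny clusters-fibres (covers fibrePartition z)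
    ... | (i , C≡) , z∈C = subst (u ∈_) (sym C≡) (∈-fibre⁺ (trans eq (∈-fibre⁻ (subst (z ∈_) C≡ z∈C))))

  module _ {A : Set} where

    uniform : (xs : List A) → 1 ℕ.≤ length xs → Distribution A
    uniform xs 1≤ = record
      { size        = length xs
      ; outcome     = lookup xs
      ; mass        = λ _ → fromℕ (length xs) ⁻¹
      ; mass-nonNeg = λ _ → inverse-nonNeg (fromℕ-pos 1≤)
      ; mass-total  = trans (sum-const (length xs)) (*-inverseʳ (<⇒≢0 (fromℕ-pos 1≤)))
      }
      where
      sum-const : ∀ {c} m → sum {m} (λ _ → c) ≡ fromℕ m * c
      sum-const {c} zero    = sym (zeroˡ c)
      sum-const {c} (suc m) = trans (cong (c +_) (sum-const m))
        (trans (cong (_+ fromℕ m * c) (sym (*-identityˡ c))) (sym (distribʳ c 1# (fromℕ m))))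

    Pr-uniform : {E : Pred A 0ℓ} (padded? : Decidable E) (xs : List A) (1≤ : 1 ℕ.≤ length xs) →
                 Pr (uniform xs 1≤) padded? ≡ fromℕ (count padded? xs) * fromℕ (length xs) ⁻¹
    Pr-uniform padded? xs _ = go xs
      where
      c : ℝ
      c = fromℕ (length xs) ⁻¹
      go : ∀ ys → sum (λ i → if does (padded? (lookup ys i)) then c else 0#) ≡ fromℕ (count padded? ys) * c
      go []       = sym (zeroˡ c)
      go (y ∷ ys) with padded? y
      ... | yes _ = trans (cong₂ _+_ (sym (*-identityˡ c)) (go ys)) (sym (distribʳ c 1# (fromℕ (count padded? ys))))
      ... | no  _ = trans (+-identityˡ _) (go ys)

-- The shortest path metric of a finite graph

finite-bound : ∀ {k} {Q : Fin k → ℕ → Set} → (∀ {i m m′} → m ℕ.≤ m′ → Q i m → Q i m′) →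
               (∀ i → ∃ (Q i)) → ∃ λ m → ∀ i → Q i m
finite-bound {zero}  mono bound = 0 , λ ()
finite-bound {suc k} mono bound with bound zero | finite-bound {k} mono (bound ∘ suc)
... | m , q | m′ , qs = m ℕ.⊔ m′ , λ { zero → mono (ℕ.m≤m⊔n m m′) q ; (suc i) → mono (ℕ.m≤n⊔m m m′) (qs i) }

module Metric (lem : ExcludedMiddle 0ℓ) (R : CompleteOrderedField) where
  open Theory lem R
  open OrderedField R
  open Exponential lem R using (archimedean)

  module _ {n} (G : WeightedGraph n) where

    walkLength-nonNeg : ∀ {u v} (w : Star (Adj G) u v) → 0# ≤ walkLength G w
    walkLength-nonNeg ε       = ≤-refl
    walkLength-nonNeg (e ◅ w) = +-nonNeg (weight-nonNeg G e) (walkLength-nonNeg w)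

    walkLength-◅◅ : ∀ {u v w} (p : Star (Adj G) u v) (q : Star (Adj G) v w) →
                    walkLength G (p ◅◅ q) ≡ walkLength G p + walkLength G q
    walkLength-◅◅ ε       q = sym (+-identityˡ _)
    walkLength-◅◅ (e ◅ p) q = trans (cong (weight G _ _ +_) (walkLength-◅◅ p q)) (sym (+-assoc _ _ _))

    reverseWalk : ∀ {u v} → Star (Adj G) u v → Star (Adj G) v u
    reverseWalk ε       = ε
    reverseWalk (e ◅ p) = reverseWalk p ◅◅ (adj-sym G e ◅ ε)

    walkLength-reverse : ∀ {u v} (p : Star (Adj G) u v) → walkLength G (reverseWalk p) ≡ walkLength G p
    walkLength-reverse ε       = refl
    walkLength-reverse (e ◅ p) = trans (walkLength-◅◅ (reverseWalk p) (adj-sym G e ◅ ε))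
      (trans (+-comm _ _) (cong₂ _+_ (trans (+-identityʳ _) (sym (weight-sym G e))) (walkLength-reverse p)))

    module _ {u v : Fin n} where
      private
        Lengths : ℝ → Set
        Lengths x = Σ (Star (Adj G) u v) λ w → x ≡ walkLength G w

        Negated : ℝ → Set
        Negated x = Lengths (- x)

        inhabited : ∃ Negated
        inhabited = - walkLength G w , w , -‿involutive _
          where w = connected G u v

        upper : ∀ {b} → (∀ w → b ≤ walkLength G w) → UpperBound Negated (- b)
        upper b≤ {x} (w , -x≡) = subst (_≤ _) (-‿involutive x) (neg-antimono-≤ (subst (_ ≤_) (sym -x≡) (b≤ w)))

        bounded : ∃ (UpperBound Negated)
        bounded = - 0# , upper walkLength-nonNeg

      dist≤walkLength : (w : Star (Adj G) u v) → dist G u v ≤ walkLength G w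
      dist≤walkLength w = subst (dist G u v ≤_) (-‿involutive _)
        (neg-antimono-≤ (⨆-upper Negated inhabited bounded (w , -‿involutive _)))

      dist-greatest : ∀ {b} → (∀ w → b ≤ walkLength G w) → b ≤ dist G u v
      dist-greatest {b} b≤ = subst (_≤ dist G u v) (-‿involutive b)
        (neg-antimono-≤ (⨆-least Negated inhabited bounded (upper b≤)))

      dist-nonNeg : 0# ≤ dist G u v
      dist-nonNeg = dist-greatest walkLength-nonNeg

    dist-self : ∀ u → dist G u u ≤ 0#
    dist-self u = dist≤walkLength ε

    dist-sym-≤ : ∀ u v → dist G u v ≤ dist G v u
    dist-sym-≤ u v = dist-greatest λ w → subst (dist G u v ≤_) (walkLength-reverse w) (dist≤walkLength (reverseWalk w))

    -- The two infima are handled one at a time: for a fixed walk p, the number dist u w - length p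
    -- is a lower bound for the lengths of all walks q; the same argument is then applied to p.
    dist-triangle : ∀ u v w → dist G u w ≤ dist G u v + dist G v w
    dist-triangle u v w = ≤+ (dist-greatest λ p → -≤ (subst (dist G u w ≤_) (+-comm _ _)
      (≤+ (dist-greatest λ q → -≤ (subst (dist G u w ≤_) (trans (walkLength-◅◅ p q) (+-comm _ _))
        (dist≤walkLength (p ◅◅ q)))))))
      where
      ≤+ : ∀ {x y z} → x + - y ≤ z → x ≤ z + y
      ≤+ {x} {y} {z} le = subst (_≤ z + y) (x-y+y≡x x y) (+-monoˡ-≤ y le)
      -≤ : ∀ {x y z} → x ≤ z + y → x + - y ≤ z
      -≤ {x} {y} {z} le = subst (x + - y ≤_) (x+y-y≡x z y) (+-monoˡ-≤ (- y) le)

    ∈-ball⁺ : ∀ {z r u} → dist G z u ≤ r → u ∈ ball G z r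
    ∈-ball⁺ {z} {r} = ∈-tabulate-does⁺ λ u → dist G z u ≤? r

    ∈-ball⁻ : ∀ {z r u} → u ∈ ball G z r → dist G z u ≤ r
    ∈-ball⁻ {z} {r} = ∈-tabulate-does⁻ λ u → dist G z u ≤? r

    centre∈ball : ∀ z {r} → 0# ≤ r → z ∈ ball G z r
    centre∈ball z 0≤r = ∈-ball⁺ (≤-trans (dist-self z) 0≤r)

    ball-mono : ∀ z {r r′} → r ≤ r′ → ball G z r ⊆ ball G z r′
    ball-mono z r≤r′ u∈ = ∈-ball⁺ (≤-trans (∈-ball⁻ u∈) r≤r′)

    ball⊆ball : ∀ {u z r r′} → dist G z u + r ≤ r′ → ball G u r ⊆ ball G z r′
    ball⊆ball {u} {z} le w∈ = ∈-ball⁺ (≤-trans (dist-triangle z u _) (≤-trans (+-mono-≤ ≤-refl (∈-ball⁻ w∈)) le))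

    -- There are finitely many pairs, so one N serves all of them. It makes the mesh H / N no larger
    -- than any nonzero distance.
    positive-distances : ∀ H → ∃ λ N → ∀ u v → dist G u v ≤ 0# ⊎ H ≤ fromℕ N * dist G u v
    positive-distances H = finite-bound (λ m≤ q v → mono m≤ (q v)) λ u → finite-bound mono (single u)
      where
      Q : Fin n → Fin n → ℕ → Set
      Q u v N = dist G u v ≤ 0# ⊎ H ≤ fromℕ N * dist G u v
      mono : ∀ {u v m m′} → m ℕ.≤ m′ → Q u v m → Q u v m′
      mono m≤m′ (inj₁ d≤0) = inj₁ d≤0
      mono m≤m′ (inj₂ H≤)  = inj₂ (≤-trans H≤ (*-monoʳ-≤ dist-nonNeg (fromℕ-mono m≤m′)))
      single : ∀ u v → ∃ (Q u v)
      single u v with dist G u v ≤? 0#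
      ... | yes d≤0 = 0 , inj₁ d≤0
      ... | no  d≰0 with archimedean (H * dist G u v ⁻¹)
      ...   | N , H/d≤N = N , inj₂ (subst (_≤ fromℕ N * dist G u v) cancel (*-monoʳ-≤ dist-nonNeg H/d≤N))
        where
        d = dist G u v
        cancel : H * d ⁻¹ * d ≡ H
        cancel = trans (*-assoc H (d ⁻¹) d) (trans
          (cong (H *_) (trans (*-comm (d ⁻¹) d) (*-inverseʳ (<⇒≢0 (≰⇒> d≰0)))))
          (*-identityʳ H))

-- Arithmetic of sums and radius indices

∑-mono : ∀ n {f g : ℕ → ℕ} → (∀ k → f k ℕ.≤ g k) → ∑ n f ℕ.≤ ∑ n g
∑-mono zero    f≤g = z≤n
∑-mono (suc n) f≤g = ℕ.+-mono-≤ (f≤g 0) (∑-mono n (f≤g ∘ suc))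

-- An integer substitute for N / ℓ, correct up to a factor 2: the quotient m is at least 1, so the
-- remainder is below ℓ ≤ m ℓ.
halving : ∀ {ℓ N} → 1 ℕ.≤ ℓ → ℓ ℕ.≤ N → ∃ λ m → m ℕ.* ℓ ℕ.≤ N × N ℕ.≤ 2 ℕ.* (m ℕ.* ℓ)
halving {ℓ@(suc _)} {N} 1≤ℓ ℓ≤N = m , m/n*n≤m N ℓ , (begin
  N                       ≡⟨ m≡m%n+[m/n]*n N ℓ ⟩
  N ℕ.% ℓ ℕ.+ m ℕ.* ℓ     ≤⟨ ℕ.+-monoˡ-≤ (m ℕ.* ℓ) (ℕ.<⇒≤ (m%n<n N ℓ)) ⟩
  ℓ ℕ.+ m ℕ.* ℓ           ≤⟨ ℕ.+-monoˡ-≤ (m ℕ.* ℓ) (ℕ.m≤n*m ℓ m {{ℕ.>-nonZero (m≥n⇒m/n>0 ℓ≤N)}}) ⟩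
  m ℕ.* ℓ ℕ.+ m ℕ.* ℓ     ≡⟨ cong (m ℕ.* ℓ ℕ.+_) (sym (ℕ.+-identityʳ (m ℕ.* ℓ))) ⟩
  2 ℕ.* (m ℕ.* ℓ)         ∎)
  where
  open ℕ.≤-Reasoning
  m = N ℕ./ ℓ

-- With b = N - ℓ the indices stay below 3 N + ℓ ≤ 4 N, the index of the padding radius of the
-- cover.
index-bound : ∀ {b ℓ N j} → ℓ ℕ.+ b ≡ N → ℓ ℕ.≤ N → j ℕ.< 2 ℕ.* N ℕ.+ 2 ℕ.* ℓ → b ℕ.+ j ℕ.≤ 4 ℕ.* N
index-bound {b} {ℓ} {N} {j} ℓ+b≡N ℓ≤N j< = begin
  b ℕ.+ j                            ≤⟨ ℕ.+-monoʳ-≤ b (ℕ.<⇒≤ j<) ⟩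
  b ℕ.+ (2 ℕ.* N ℕ.+ 2 ℕ.* ℓ)        ≡⟨ identity b ℓ N ⟩
  (ℓ ℕ.+ b) ℕ.+ ℓ ℕ.+ 2 ℕ.* N        ≡⟨ cong (λ m → m ℕ.+ ℓ ℕ.+ 2 ℕ.* N) ℓ+b≡N ⟩
  N ℕ.+ ℓ ℕ.+ 2 ℕ.* N                ≤⟨ ℕ.+-monoˡ-≤ (2 ℕ.* N) (ℕ.+-monoʳ-≤ N ℓ≤N) ⟩
  N ℕ.+ N ℕ.+ 2 ℕ.* N                ≡⟨ identity′ N ⟩
  4 ℕ.* N                            ∎
  where
  open ℕ.≤-Reasoning
  identity : ∀ b ℓ N → b ℕ.+ (2 ℕ.* N ℕ.+ 2 ℕ.* ℓ) ≡ (ℓ ℕ.+ b) ℕ.+ ℓ ℕ.+ 2 ℕ.* N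
  identity = solve-∀
  identity′ : ∀ N → N ℕ.+ N ℕ.+ 2 ℕ.* N ≡ 4 ℕ.* N
  identity′ = solve-∀

-- The random partition

module Padding (lem : ExcludedMiddle 0ℓ) (R : CompleteOrderedField) where
  open Theory lem R
  open OrderedField R
  open Exponential lem R
  open Partitions lem R
  open Metric lem R
  open ≤-Reasoning

  -- Stands for s ^ (ℓ / N) ≤ exp (32 g ln s) without rational powers. With m from `halving`, 16 g m
  -- ≥ 1, hence s ≤ exp (2 ln s) ≤ exp (m x) ≤ (exp x) ^ m; raising this to the power 2 ℓ and using
  -- m ℓ ≤ N finishes. The case ℓ = 0 has no quotient m.
  ^≤expSeries-^ : ∀ {s ℓ N g} → 1 ℕ.≤ s → ℓ ℕ.≤ N → 0# ≤ g →
                  fromℕ ℓ ≤ fromℕ 8 * (g * fromℕ N) →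
                  fromℕ s ^ (2 ℕ.* ℓ) ≤ expSeries (fromℕ 32 * (g * ln (fromℕ s))) ^ (2 ℕ.* N)
  ^≤expSeries-^ {s} {zero}      {N} {g} 1≤s ℓ≤N 0≤g ℓ≤8gN =
    1≤^ (2 ℕ.* N) (1≤expSeries (*-nonNeg (fromℕ-nonNeg 32) (*-nonNeg 0≤g (ln-nonNeg 1≤s))))
  ^≤expSeries-^ {s} {ℓ@(suc _)} {N} {g} 1≤s ℓ≤N 0≤g ℓ≤8gN with halving (s≤s z≤n) ℓ≤N
  ... | m , mℓ≤N , N≤2mℓ = begin
    fromℕ s ^ (2 ℕ.* ℓ)          ≤⟨ ^-monoˡ-≤ (2 ℕ.* ℓ) (fromℕ-nonNeg s) s≤E^m ⟩
    (expSeries x ^ m) ^ (2 ℕ.* ℓ) ≡⟨ ^-assocʳ (expSeries x) m (2 ℕ.* ℓ) ⟩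
    expSeries x ^ (m ℕ.* (2 ℕ.* ℓ)) ≤⟨ ^-monoʳ-≤ (1≤expSeries 0≤x) m2ℓ≤2N ⟩
    expSeries x ^ (2 ℕ.* N)       ∎
    where
    L = ln (fromℕ s)
    x = fromℕ 32 * (g * L)
    0≤L : 0# ≤ L
    0≤L = ln-nonNeg 1≤s
    0≤x : 0# ≤ x
    0≤x = *-nonNeg (fromℕ-nonNeg 32) (*-nonNeg 0≤g 0≤L)
    m2ℓ≤2N : m ℕ.* (2 ℕ.* ℓ) ℕ.≤ 2 ℕ.* N
    m2ℓ≤2N = subst (ℕ._≤ 2 ℕ.* N) (identity m ℓ) (ℕ.*-monoʳ-≤ 2 mℓ≤N)
      where
      identity : ∀ m ℓ → 2 ℕ.* (m ℕ.* ℓ) ≡ m ℕ.* (2 ℕ.* ℓ)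
      identity = solve-∀
    1≤16gm : 1# ≤ fromℕ 16 * (g * fromℕ m)
    1≤16gm = *-cancelʳ-≤ (fromℕ-pos (s≤s (z≤n {ℓ ℕ.∸ 1}))) (begin
      1# * fromℕ ℓ                                    ≡⟨ *-identityˡ _ ⟩
      fromℕ ℓ                                         ≤⟨ ℓ≤8gN ⟩
      fromℕ 8 * (g * fromℕ N)
        ≤⟨ *-monoˡ-≤ (fromℕ-nonNeg 8) (*-monoˡ-≤ 0≤g (fromℕ-mono N≤2mℓ)) ⟩
      fromℕ 8 * (g * fromℕ (2 ℕ.* (m ℕ.* ℓ)))
        ≡⟨ cong (λ t → fromℕ 8 * (g * t)) (trans (fromℕ-* 2 (m ℕ.* ℓ)) (cong (fromℕ 2 *_) (fromℕ-* m ℓ))) ⟩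
      fromℕ 8 * (g * (fromℕ 2 * (fromℕ m * fromℕ ℓ)))
        ≡⟨ Solver.solve 5 (λ a b g m l → a :* (g :* (b :* (m :* l))) := a :* b :* (g :* m) :* l)
             refl (fromℕ 8) (fromℕ 2) g (fromℕ m) (fromℕ ℓ) ⟩
      fromℕ 8 * fromℕ 2 * (g * fromℕ m) * fromℕ ℓ
        ≡⟨ cong (λ t → t * (g * fromℕ m) * fromℕ ℓ) (sym (fromℕ-* 8 2)) ⟩
      fromℕ 16 * (g * fromℕ m) * fromℕ ℓ              ∎)
      where open Solver using (_:*_; _:=_)
    2L≤mx : L + L ≤ fromℕ m * x
    2L≤mx = begin
      L + L                                      ≡⟨ trans (cong (L +_) (sym (+-identityʳ L))) (·-* 2 L) ⟩
      fromℕ 2 * L                                ≡⟨ cong (fromℕ 2 *_) (sym (*-identityˡ L)) ⟩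
      fromℕ 2 * (1# * L)                         ≤⟨ *-monoˡ-≤ (fromℕ-nonNeg 2) (*-monoʳ-≤ 0≤L 1≤16gm) ⟩
      fromℕ 2 * (fromℕ 16 * (g * fromℕ m) * L)
        ≡⟨ Solver.solve 5 (λ a b g m l → a :* (b :* (g :* m) :* l) := m :* (a :* b :* (g :* l)))
             refl (fromℕ 2) (fromℕ 16) g (fromℕ m) L ⟩
      fromℕ m * (fromℕ 2 * fromℕ 16 * (g * L))   ≡⟨ cong (λ t → fromℕ m * (t * (g * L))) (sym (fromℕ-* 2 16)) ⟩
      fromℕ m * x                                ∎
      where open Solver using (_:*_; _:=_)
    s≤E^m : fromℕ s ≤ expSeries x ^ m
    s≤E^m = begin
      fromℕ s               ≤⟨ ≤expSeries-2ln 1≤s ⟩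
      expSeries (L + L)     ≤⟨ expSeries-mono (+-nonNeg 0≤L 0≤L) 2L≤mx ⟩
      expSeries (fromℕ m * x) ≤⟨ expSeries-· m 0≤x ⟩
      expSeries x ^ m       ∎

  least-multiple : ∀ {h ρ} → 0# ≤ ρ → 0# ≤ h → ∀ N → ρ ≤ fromℕ N * h →
                   ∃ λ ℓ → ℓ ℕ.≤ N × ρ ≤ fromℕ ℓ * h × fromℕ ℓ * h ≤ ρ + h
  least-multiple {h} {ρ} 0≤ρ 0≤h zero    ρ≤ = 0 , z≤n , ρ≤ , subst (_≤ ρ + h) (sym (zeroˡ h)) (+-nonNeg 0≤ρ 0≤h)
  least-multiple {h} {ρ} 0≤ρ 0≤h (suc N) ρ≤ with ≤-total ρ (fromℕ N * h)
  ... | inj₁ ρ≤Nh = let ℓ , ℓ≤N , bounds = least-multiple 0≤ρ 0≤h N ρ≤Nh in ℓ , ℕ.m≤n⇒m≤1+n ℓ≤N , bounds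
  ... | inj₂ Nh≤ρ = suc N , ℕ.≤-refl , ρ≤ ,
    subst (_≤ ρ + h) (trans (+-comm _ _) (trans (cong (_+ fromℕ N * h) (sym (*-identityˡ h))) (sym (distribʳ h 1# (fromℕ N)))))
      (+-monoˡ-≤ h Nh≤ρ)

  -- Every distance is 0 or at least h, so a ball of radius below h is the ball
  -- of radius 0; this avoids an additive error h in ℓ h ≤ 2 ρ.
  discretise : ∀ {n} (G : WeightedGraph n) {h ρ} z N → 0# ≤ ρ → 0# ≤ h → ρ ≤ fromℕ N * h →
               (∀ u → dist G z u ≤ 0# ⊎ h ≤ dist G z u) →
               ∃ λ ℓ → ℓ ℕ.≤ N × (∀ u → dist G z u ≤ ρ → dist G z u ≤ fromℕ ℓ * h) × fromℕ ℓ * h ≤ ρ + ρ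
  discretise G {h} {ρ} z N 0≤ρ 0≤h ρ≤Nh gap with h ≤? ρ
  ... | yes h≤ρ = let ℓ , ℓ≤N , ρ≤ℓh , ℓh≤ = least-multiple 0≤ρ 0≤h N ρ≤Nh in
    ℓ , ℓ≤N , (λ u d≤ρ → ≤-trans d≤ρ ρ≤ℓh) , ≤-trans ℓh≤ (+-mono-≤ ≤-refl h≤ρ)
  ... | no  h≰ρ = 0 , z≤n , (λ u d≤ρ → subst (dist G z u ≤_) (sym (zeroˡ h)) (near u d≤ρ (gap u))) ,
    subst (_≤ ρ + ρ) (sym (zeroˡ h)) (+-nonNeg 0≤ρ 0≤ρ)
    where
    near : ∀ u → dist G z u ≤ ρ → dist G z u ≤ 0# ⊎ h ≤ dist G z u → dist G z u ≤ 0#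
    near u d≤ρ (inj₁ d≤0) = d≤0
    near u d≤ρ (inj₂ h≤d) = contradiction (≤-trans h≤d d≤ρ) h≰ρ

  module _ {n} (G : WeightedGraph n) {β Δ : ℝ} {s : ℕ} (0<β : 0# < β) (0<Δ : 0# < Δ) (1≤s : 1 ℕ.≤ s)
           {𝒞 : List (Subset n)} (cover : IsSparseCover G β s Δ 𝒞) where

    private
      module Cover = IsSparseCover cover

      q H : ℝ
      q = 1# ÷ (fromℕ 4 * β)
      H = q * Δ

      0<4β : 0# < fromℕ 4 * β
      0<4β = *-pos (fromℕ-pos {4} (s≤s z≤n)) 0<β

      4βq≡1 : fromℕ 4 * β * q ≡ 1#
      4βq≡1 = trans (cong (fromℕ 4 * β *_) (*-identityˡ _)) (*-inverseʳ (<⇒≢0 0<4β))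

      0≤q : 0# ≤ q
      0≤q = *-nonNeg 0≤1 (inverse-nonNeg 0<4β)

      0≤H : 0# ≤ H
      0≤H = *-nonNeg 0≤q (proj₁ 0<Δ)

      -- The successor makes N positive, as the division in h requires, and preserves the bound that
      -- `positive-distances` gives for N₀.
      N₀ N : ℕ
      N₀ = proj₁ (positive-distances G H)
      N  = suc N₀

      h : ℝ
      h = H * fromℕ N ⁻¹

      0<N : 0# < fromℕ N
      0<N = fromℕ-pos {N} (s≤s z≤n)

      0≤h : 0# ≤ h
      0≤h = *-nonNeg 0≤H (inverse-nonNeg 0<N)

      Nh≡H : fromℕ N * h ≡ H
      Nh≡H = trans (*-comm _ _) (trans (*-assoc H _ _) (trans
        (cong (H *_) (trans (*-comm _ _) (*-inverseʳ (<⇒≢0 0<N)))) (*-identityʳ H)))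

      -- The largest radius in play is exactly the one at which the cover is padded.
      4Nh≡Δ/β : fromℕ (4 ℕ.* N) * h ≡ Δ ÷ β
      4Nh≡Δ/β = begin-equality
        fromℕ (4 ℕ.* N) * h                 ≡⟨ cong (_* h) (fromℕ-* 4 N) ⟩
        fromℕ 4 * fromℕ N * h               ≡⟨ trans (*-assoc _ _ _) (cong (fromℕ 4 *_) Nh≡H) ⟩
        fromℕ 4 * (q * Δ)                   ≡⟨ sym (*-identityʳ _) ⟩
        fromℕ 4 * (q * Δ) * 1#              ≡⟨ cong (fromℕ 4 * (q * Δ) *_) (sym (*-inverseʳ (<⇒≢0 0<β))) ⟩
        fromℕ 4 * (q * Δ) * (β * β ⁻¹)
          ≡⟨ Solver.solve 5 (λ a q d b b′ → a :* (q :* d) :* (b :* b′) := a :* b :* q :* (d :* b′))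
               refl (fromℕ 4) q Δ β (β ⁻¹) ⟩
        fromℕ 4 * β * q * (Δ * β ⁻¹)        ≡⟨ trans (cong (_* (Δ * β ⁻¹)) 4βq≡1) (*-identityˡ _) ⟩
        Δ ÷ β                               ∎
        where open Solver using (_:*_; _:=_)

      gap : ∀ u v → dist G u v ≤ 0# ⊎ h ≤ dist G u v
      gap u v with proj₂ (positive-distances G H) u v
      ... | inj₁ d≤0 = inj₁ d≤0
      ... | inj₂ H≤N₀d = inj₂ (*-cancelʳ-≤ 0<N (begin
        h * fromℕ N          ≡⟨ trans (*-comm _ _) Nh≡H ⟩
        H                    ≤⟨ H≤N₀d ⟩
        fromℕ N₀ * dist G u v ≤⟨ *-monoʳ-≤ (dist-nonNeg G) (fromℕ-mono (ℕ.n≤1+n N₀)) ⟩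
        fromℕ N * dist G u v ≡⟨ *-comm _ _ ⟩
        dist G u v * fromℕ N ∎))

      radius : ℕ → ℝ
      radius j = fromℕ j * h

      radius-nonNeg : ∀ j → 0# ≤ radius j
      radius-nonNeg j = *-nonNeg (fromℕ-nonNeg j) 0≤h

      radius-mono : ∀ {i j} → i ℕ.≤ j → radius i ≤ radius j
      radius-mono i≤j = *-monoʳ-≤ 0≤h (fromℕ-mono i≤j)

      radius-+ : ∀ i j → radius (i ℕ.+ j) ≡ radius i + radius j
      radius-+ i j = trans (cong (_* h) (fromℕ-+ i j)) (distribʳ h (fromℕ i) (fromℕ j))

      InCore : ℕ → Fin n → Subset n → Set
      InCore j v C = ball G v (radius j) ⊆ C

      inCore? : ∀ j v → Decidable (InCore j v)
      inCore? j v C = ball G v (radius j) ⊆? C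

      inCore-≤4N : ∀ {j} v → j ℕ.≤ 4 ℕ.* N → Any (InCore j v) 𝒞
      inCore-≤4N {j} v j≤4N = Any.map 
        (λ ball⊆C {u} u∈ → ball⊆C (ball-mono G v (subst (radius j ≤_) 4Nh≡Δ/β (radius-mono j≤4N)) u∈))
        (Cover.padded v)

      label : ℕ → (π : List (Subset n)) → Fin n → Fin (suc (length π))
      label k π v = firstIndex (inCore? (N ℕ.+ k) v) π

      partition : ℕ → List (Subset n) → Partition n
      partition k π = fibrePartition (label k π)

      orders : List (List (Subset n))
      orders = permutations (length 𝒞) 𝒞

      outcomes : List (Partition n)
      outcomes = concatMap (λ k → map (partition k) orders) (upTo (2 ℕ.* N))

      length-outcomes : length outcomes ≡ 2 ℕ.* N ℕ.* length 𝒞 !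
      length-outcomes = trans
        (length-concatMap (λ k → map (partition k) orders) (All.universal
          (λ k → trans (length-map (partition k) orders) (length-permutations (length 𝒞) 𝒞 refl)) (upTo (2 ℕ.* N))))
        (cong (ℕ._* length 𝒞 !) (length-upTo (2 ℕ.* N)))

      1≤outcomes : 1 ℕ.≤ length outcomes
      1≤outcomes = subst (1 ℕ.≤_) (sym length-outcomes) (ℕ.*-mono-≤ {1} {2 ℕ.* N} (s≤s z≤n) (ℕ.1≤n! (length 𝒞)))

      N+k≤4N : ∀ {k} → k ℕ.< 2 ℕ.* N → N ℕ.+ k ℕ.≤ 4 ℕ.* N
      N+k≤4N {k} k<2N = ℕ.≤-trans (ℕ.+-monoʳ-≤ N (ℕ.<⇒≤ k<2N)) (ℕ.*-monoˡ-≤ N (s≤s (s≤s (s≤s (z≤n {1})))))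

      -- Vertices with equal labels share a cluster of the cover that contains both balls, hence
      -- both centres. The default label never occurs, because the radius is at most Δ / β.
      partition-bounded : ∀ {k π} → k ℕ.< 2 ℕ.* N → π ↭ 𝒞 → All (DiameterAtMost G Δ) (clusters (partition k π))
      partition-bounded {k} {π} k<2N π↭𝒞 = All.map diameter (clusters-fibres (label k π))
        where
        diameter : ∀ {C} → ∃ (λ i → C ≡ fibre (label k π) i) → DiameterAtMost G Δ C
        diameter (i , refl) {u} {v} u∈ v∈
          with firstIndex-common (inCore? (N ℕ.+ k) u) (inCore? (N ℕ.+ k) v)
                 (trans (∈-fibre⁻ (label k π) u∈) (sym (∈-fibre⁻ (label k π) v∈)))
                 (Any-resp-↭ (↭-sym π↭𝒞) (inCore-≤4N u (N+k≤4N k<2N)))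
        ... | C , C∈π , ball-u⊆C , ball-v⊆C = All.lookup (All-resp-↭ (↭-sym π↭𝒞) Cover.bounded) C∈π
          (ball-u⊆C (centre∈ball G u (radius-nonNeg (N ℕ.+ k)))) (ball-v⊆C (centre∈ball G v (radius-nonNeg (N ℕ.+ k))))

      outcomes-bounded : All (λ P → All (DiameterAtMost G Δ) (clusters P)) outcomes
      outcomes-bounded = All.concat⁺ (All.map⁺ (All.map
        (λ k<2N → All.map⁺ (All.map (partition-bounded k<2N) (permutations-↭ (length 𝒞) 𝒞 refl)))
        (All.tabulate {xs = upTo (2 ℕ.* N)} ∈-upTo⁻)))

      module Padded (γ : ℝ) (z : Fin n) (0≤γ : 0# ≤ γ) (γ≤q : γ ≤ q) where

        ρ : ℝ
        ρ = γ * Δ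

        discretised : ∃ λ ℓ → ℓ ℕ.≤ N × (∀ u → dist G z u ≤ ρ → dist G z u ≤ radius ℓ) × radius ℓ ≤ ρ + ρ
        discretised = discretise G z N (*-nonNeg 0≤γ (proj₁ 0<Δ)) 0≤h
          (subst (ρ ≤_) (sym Nh≡H) (*-monoʳ-≤ (proj₁ 0<Δ) γ≤q)) (gap z)

        ℓ b : ℕ
        ℓ = proj₁ discretised
        b = N ℕ.∸ ℓ

        ℓ≤N : ℓ ℕ.≤ N
        ℓ≤N = proj₁ (proj₂ discretised)

        ℓ+b≡N : ℓ ℕ.+ b ≡ N
        ℓ+b≡N = ℕ.m+[n∸m]≡n ℓ≤N

        -- The shift by b = N - ℓ puts the radii r - ℓ h and r + ℓ h, for r = (N + k) h, at the
        -- arguments k and 2 ℓ + k.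
        f : ℕ → ℕ
        f j = count (inCore? (b ℕ.+ j) z) 𝒞

        b+j≤4N : ∀ {j} → j ℕ.< 2 ℕ.* N ℕ.+ 2 ℕ.* ℓ → b ℕ.+ j ℕ.≤ 4 ℕ.* N
        b+j≤4N = index-bound ℓ+b≡N ℓ≤N

        1≤f : ∀ j → j ℕ.< 2 ℕ.* N ℕ.+ 2 ℕ.* ℓ → 1 ℕ.≤ f j
        1≤f j j< = filter-some (inCore? (b ℕ.+ j) z) (inCore-≤4N z (b+j≤4N j<))

        f≤s : ∀ j → f j ℕ.≤ s
        f≤s j = ℕ.≤-trans
          (count-mono (inCore? (b ℕ.+ j) z) (z ∈?_)
            (All.universal (λ C ball⊆C → ball⊆C (centre∈ball G z (radius-nonNeg (b ℕ.+ j)))) 𝒞))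
          (Cover.sparse z)

        Swallows? : ∀ k → Decidable (InCore (b ℕ.+ (2 ℕ.* ℓ ℕ.+ k)) z)
        Swallows? k = inCore? (b ℕ.+ (2 ℕ.* ℓ ℕ.+ k)) z

        swallows⇒touches : ∀ k {C} → InCore (b ℕ.+ (2 ℕ.* ℓ ℕ.+ k)) z C → InCore (b ℕ.+ k) z C
        swallows⇒touches k ball⊆C {w} w∈ = ball⊆C (ball-mono G z (radius-mono (ℕ.+-monoʳ-≤ b (ℕ.m≤n+m k (2 ℕ.* ℓ)))) w∈)

        good? : ∀ k → Decidable (FirstIn (Swallows? k) (inCore? (b ℕ.+ k) z) (swallows⇒touches k))
        good? k = firstIn? (Swallows? k) (inCore? (b ℕ.+ k) z) (swallows⇒touches k)

        goodOrders : ℕ → ℕ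
        goodOrders k = count (good? k) orders

        module _ (k : ℕ) {u : Fin n} (near : dist G z u ≤ radius ℓ) where

          -- For u within ℓ h of z, the r-ball around u is squeezed between the balls around z of
          -- radii r - ℓ h and r + ℓ h. This and `inCore⇒touches` are the two inclusions.
          swallows⇒inCore : ∀ {C} → InCore (b ℕ.+ (2 ℕ.* ℓ ℕ.+ k)) z C → InCore (N ℕ.+ k) u C
          swallows⇒inCore ball⊆C {w} w∈ = ball⊆C (ball⊆ball G {u} {z} (≤-trans (+-monoˡ-≤ _ near)
            (≤-reflexive (trans (sym (radius-+ ℓ (N ℕ.+ k))) (cong radius index)))) w∈)
            where
            identity : ∀ b ℓ k → ℓ ℕ.+ ((ℓ ℕ.+ b) ℕ.+ k) ≡ b ℕ.+ (2 ℕ.* ℓ ℕ.+ k)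
            identity = solve-∀
            index : ℓ ℕ.+ (N ℕ.+ k) ≡ b ℕ.+ (2 ℕ.* ℓ ℕ.+ k)
            index = trans (cong (λ m → ℓ ℕ.+ (m ℕ.+ k)) (sym ℓ+b≡N)) (identity b ℓ k)

          inCore⇒touches : ∀ {C} → InCore (N ℕ.+ k) u C → InCore (b ℕ.+ k) z C
          inCore⇒touches ball⊆C {w} w∈ = ball⊆C (ball⊆ball G {z} {u} (≤-trans (+-monoˡ-≤ _ (≤-trans (dist-sym-≤ G u z) near))
            (≤-reflexive (trans (sym (radius-+ ℓ (b ℕ.+ k))) (cong radius index)))) w∈)
            where
            index : ℓ ℕ.+ (b ℕ.+ k) ≡ N ℕ.+ k
            index = trans (sym (ℕ.+-assoc ℓ b k)) (cong (ℕ._+ k) ℓ+b≡N)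

        padded? : Decidable (λ P → ball G z ρ ⊆ clusterOf P z)
        padded? P = ball G z ρ ⊆? clusterOf P z

        -- In a good order the sandwich holds for z and for each u in its ball, so all of them
        -- choose the same cluster.
        good⇒padded : ∀ k {π} → FirstIn (Swallows? k) (inCore? (b ℕ.+ k) z) (swallows⇒touches k) π →
                      ball G z ρ ⊆ clusterOf (partition k π) z
        good⇒padded k {π} good {u} u∈ = ∈-clusterOf (label k π)
          (firstIndex-FirstIn (Swallows? k) (inCore? (b ℕ.+ k) z) (swallows⇒touches k)
            (inCore? (N ℕ.+ k) u) (inCore? (N ℕ.+ k) z)
            (swallows⇒inCore k near) (swallows⇒inCore k near-z) (inCore⇒touches k near) (inCore⇒touches k near-z) good)
          where
          near : dist G z u ≤ radius ℓ
          near = proj₁ (proj₂ (proj₂ discretised)) u (∈-ball⁻ G u∈)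
          near-z : dist G z z ≤ radius ℓ
          near-z = ≤-trans (dist-self G z) (radius-nonNeg ℓ)

        ∑goodOrders≤ : ∑ (2 ℕ.* N) goodOrders ℕ.≤ count padded? outcomes
        ∑goodOrders≤ = ℕ.≤-trans (∑-mono (2 ℕ.* N) λ k → ℕ.≤-trans
            (count-mono (good? k) (padded? ∘ partition k) (All.universal (λ _ → good⇒padded k) orders))
            (ℕ.≤-reflexive (sym (count-map padded? (padded? ∘ partition k) (partition k) (λ _ → id , id) orders))))
          (ℕ.≤-reflexive (sym (trans (count-concatMap padded? (λ k → map (partition k) orders) (upTo (2 ℕ.* N)))
            (cong ListAction.sum (map-upTo (λ k → count padded? (map (partition k) orders)) (2 ℕ.* N))))))

        -- The bound Pr ^ (2 N) ≥ s ^ (- 2 ℓ) with denominators cleared.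
        counting : length outcomes ℕ.^ (2 ℕ.* N) ℕ.≤ count padded? outcomes ℕ.^ (2 ℕ.* N) ℕ.* s ℕ.^ (2 ℕ.* ℓ)
        counting = ℕ.≤-trans
          (subst (λ m → m ℕ.^ (2 ℕ.* N) ℕ.≤ ∑ (2 ℕ.* N) goodOrders ℕ.^ (2 ℕ.* N) ℕ.* s ℕ.^ (2 ℕ.* ℓ))
            (sym length-outcomes)
            (telescoping-am-gm (2 ℕ.* N) (2 ℕ.* ℓ) s (length 𝒞 !) f goodOrders 1≤f (λ j _ → f≤s j)
              λ k _ → count-firstIn (Swallows? k) (inCore? (b ℕ.+ k) z) (swallows⇒touches k) (length 𝒞) 𝒞 refl))
          (ℕ.*-monoˡ-≤ (s ℕ.^ (2 ℕ.* ℓ)) (ℕ.^-monoˡ-≤ (2 ℕ.* N) ∑goodOrders≤))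

        -- Combines ℓ h ≤ 2 γ Δ with h = Δ / (4 β N); since h is itself a multiple of Δ, it is Δ
        -- that cancels.
        ℓ≤8βγN : fromℕ ℓ ≤ fromℕ 8 * (β * γ * fromℕ N)
        ℓ≤8βγN = *-cancelʳ-≤ 0<Δ (begin
          fromℕ ℓ * Δ
            ≡⟨ sym (trans (cong (_* (fromℕ ℓ * Δ)) 4βq≡1) (*-identityˡ _)) ⟩
          fromℕ 4 * β * q * (fromℕ ℓ * Δ)
            ≡⟨ Solver.solve 5 (λ a b q l d → a :* b :* q :* (l :* d) := a :* b :* (l :* (q :* d)))
                 refl (fromℕ 4) β q (fromℕ ℓ) Δ ⟩
          fromℕ 4 * β * (fromℕ ℓ * H)
            ≡⟨ cong (λ t → fromℕ 4 * β * (fromℕ ℓ * t)) (sym Nh≡H) ⟩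
          fromℕ 4 * β * (fromℕ ℓ * (fromℕ N * h))
            ≡⟨ Solver.solve 5 (λ a b l n h → a :* b :* (l :* (n :* h)) := a :* b :* n :* (l :* h))
                 refl (fromℕ 4) β (fromℕ ℓ) (fromℕ N) h ⟩
          fromℕ 4 * β * fromℕ N * radius ℓ
            ≤⟨ *-monoˡ-≤ (*-nonNeg (proj₁ 0<4β) (proj₁ 0<N)) (proj₂ (proj₂ (proj₂ discretised))) ⟩
          fromℕ 4 * β * fromℕ N * (ρ + ρ)
            ≡⟨ cong (fromℕ 4 * β * fromℕ N *_) (trans (cong (ρ +_) (sym (+-identityʳ ρ))) (·-* 2 ρ)) ⟩
          fromℕ 4 * β * fromℕ N * (fromℕ 2 * ρ)
            ≡⟨ Solver.solve 6 (λ a c b n g d → a :* b :* n :* (c :* (g :* d)) := a :* c :* (b :* g :* n) :* d)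
                 refl (fromℕ 4) (fromℕ 2) β (fromℕ N) γ Δ ⟩
          fromℕ 4 * fromℕ 2 * (β * γ * fromℕ N) * Δ
            ≡⟨ cong (λ t → t * (β * γ * fromℕ N) * Δ) (sym (fromℕ-* 4 2)) ⟩
          fromℕ 8 * (β * γ * fromℕ N) * Δ ∎)
          where open Solver using (_:*_; _:=_)

        x : ℝ
        x = fromℕ 32 * (β * γ * ln (fromℕ s))

        0≤x : 0# ≤ x
        0≤x = *-nonNeg (fromℕ-nonNeg 32) (*-nonNeg (*-nonNeg (proj₁ 0<β) 0≤γ) (ln-nonNeg 1≤s))

        E : ℝ
        E = expSeries x

        0<E : 0# < E
        0<E = <-≤-trans 0<1 (1≤expSeries 0≤x)

        size≤count*E : fromℕ (length outcomes) ≤ fromℕ (count padded? outcomes) * E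
        -- The cancelled exponent must have the form `suc n`; here it is 2 N, positive because N is
        -- a successor.
        size≤count*E = ^-cancel-≤ (ℕ.pred (2 ℕ.* N)) (*-nonNeg (fromℕ-nonNeg (count padded? outcomes)) (proj₁ 0<E)) (begin
          fromℕ (length outcomes) ^ (2 ℕ.* N)
            ≡⟨ sym (fromℕ-^ (length outcomes) (2 ℕ.* N)) ⟩
          fromℕ (length outcomes ℕ.^ (2 ℕ.* N))
            ≤⟨ fromℕ-mono counting ⟩
          fromℕ (count padded? outcomes ℕ.^ (2 ℕ.* N) ℕ.* s ℕ.^ (2 ℕ.* ℓ))
            ≡⟨ trans (fromℕ-* (count padded? outcomes ℕ.^ (2 ℕ.* N)) (s ℕ.^ (2 ℕ.* ℓ)))
                 (cong₂ _*_ (fromℕ-^ (count padded? outcomes) (2 ℕ.* N)) (fromℕ-^ s (2 ℕ.* ℓ))) ⟩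
          fromℕ (count padded? outcomes) ^ (2 ℕ.* N) * fromℕ s ^ (2 ℕ.* ℓ)
            ≤⟨ *-monoˡ-≤ (^-nonNeg (2 ℕ.* N) (fromℕ-nonNeg (count padded? outcomes)))
                 (^≤expSeries-^ 1≤s ℓ≤N (*-nonNeg (proj₁ 0<β) 0≤γ) ℓ≤8βγN) ⟩
          fromℕ (count padded? outcomes) ^ (2 ℕ.* N) * E ^ (2 ℕ.* N)
            ≡⟨ sym (^-distribʳ (fromℕ (count padded? outcomes)) E (2 ℕ.* N)) ⟩
          (fromℕ (count padded? outcomes) * E) ^ (2 ℕ.* N) ∎)

        exp≤Pr : exp (- x) ≤ Pr (uniform outcomes 1≤outcomes) padded?
        exp≤Pr = *-cancelʳ-≤ 0<E (begin
          exp (- x) * E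
            ≡⟨ trans (cong (_* E) (exp-neg 0≤x)) (trans (*-comm _ _) (*-inverseʳ (<⇒≢0 0<E))) ⟩
          1#
            ≡⟨ sym (*-inverseʳ (<⇒≢0 0<Z)) ⟩
          Z * Z ⁻¹
            ≤⟨ *-monoʳ-≤ (inverse-nonNeg 0<Z) size≤count*E ⟩
          fromℕ (count padded? outcomes) * E * Z ⁻¹
            ≡⟨ Solver.solve 3 (λ c e z → c :* e :* z := c :* z :* e) refl (fromℕ (count padded? outcomes)) E (Z ⁻¹) ⟩
          fromℕ (count padded? outcomes) * Z ⁻¹ * E
            ≡⟨ cong (_* E) (sym (Pr-uniform padded? outcomes 1≤outcomes)) ⟩
          Pr (uniform outcomes 1≤outcomes) padded? * E ∎)
          where
          open Solver using (_:*_; _:=_)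
          Z : ℝ
          Z = fromℕ (length outcomes)
          0<Z : 0# < Z
          0<Z = fromℕ-pos 1≤outcomes

      -- The factor ln 2 in the constant cancels the denominator of `log₂`, leaving the natural
      -- logarithm in which the estimate was proved.
      exponent : ∀ γ → fromℕ 32 * ln (fromℕ 2) * β * log₂ (fromℕ s) * γ ≡ fromℕ 32 * (β * γ * ln (fromℕ s))
      exponent γ = begin-equality
        a * l * β * (L * l ⁻¹) * γ
          ≡⟨ Solver.solve 6 (λ a l b L l′ g → a :* l :* b :* (L :* l′) :* g := a :* (b :* g :* L) :* (l :* l′))
               refl a l β L (l ⁻¹) γ ⟩
        a * (β * γ * L) * (l * l ⁻¹)
          ≡⟨ trans (cong (a * (β * γ * L) *_) (*-inverseʳ (<⇒≢0 (ln-pos {2} (s≤s (s≤s z≤n)))))) (*-identityʳ _) ⟩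
        a * (β * γ * L)                ∎
        where
        open Solver using (_:*_; _:=_)
        a = fromℕ 32
        l = ln (fromℕ 2)
        L = ln (fromℕ s)

    paddedDecomposition : HasPaddedDecomposition G (fromℕ 32 * ln (fromℕ 2) * β * log₂ (fromℕ s)) (1# ÷ (fromℕ 4 * β)) Δ
    paddedDecomposition = uniform outcomes 1≤outcomes , record
      { bounded = λ { P (i , refl , _) → All.lookup outcomes-bounded (∈-lookup i) }
      ; padded  = λ γ z 0≤γ γ≤q → subst
          (λ y → exp (- y) ≤ Pr (uniform outcomes 1≤outcomes) (λ P → ball G z (γ * Δ) ⊆? clusterOf P z))
          (sym (exponent γ)) (Padded.exp≤Pr γ z 0≤γ γ≤q)
      }

theorem4 : (lem : ExcludedMiddle 0ℓ) (R : CompleteOrderedField) →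
    let open Theory lem R in
    ∃ λ (K : ℝ) → 0# < K ×
    (∀ {n} (G : WeightedGraph n) (β Δ : ℝ) (s : ℕ) →
    0# < β → 0# < Δ → 1 ℕ.≤ s →
    HasSparseCover G β s Δ →
    HasPaddedDecomposition G (K * β * log₂ (fromℕ s)) (1# ÷ (fromℕ 4 * β)) Δ)
theorem4 lem R = fromℕ 32 * ln (fromℕ 2) , *-pos (fromℕ-pos {32} (s≤s z≤n)) (ln-pos {2} (s≤s (s≤s z≤n))) ,
  λ G β Δ s 0<β 0<Δ 1≤s (𝒞 , cover) → paddedDecomposition G 0<β 0<Δ 1≤s cover
  where
  open Theory lem R
  open OrderedField R
  open Exponential lem R
  open Padding lem R
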